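{- Let $(X,\mathcal R)$ be a symmetric association scheme with Bose–Mesner algebra $\mathbb A$. Consider the rooted diagrams, each with root list $(r_1,r_2,r_3)$: $\Delta$ with edges $r_1r_2,r_2r_3,r_3r_1$; $Y$ with an extra node $c$ and edges $cr_1,cr_2,cr_3$; $N$ with extra nodes $t_1,t_2,t_3$ and edges $t_1t_2,t_2t_3,t_3t_1,r_1t_1,r_2t_2,r_3t_3$; $K$ with an extra node $c$ and edges $r_1r_2,r_2r_3,r_3r_1,cr_1,cr_2,cr_3$. Then (i) $(X,\mathcal R)$ is triply regular if and only if $\mathbf W(\Delta;\mathbb A)=\mathbf W(K;\mathbb A)$; (ii) $(X,\mathcal R)$ is dually triply regular if and only if $\mathbf W(Y;\mathbb A)=\mathbf W(N;\mathbb A)$.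
   Context: A symmetric association scheme is a finite set $X$ with symmetric relations $R_0$ (identity),$R_1,\dots,R_d$ partitioning $X\times X$ such that for $(a,b)\in R_k$ the number of $c$ with $(a,c)\in R_i,(c,b)\in R_j$ depends only on $i,j,k$; $A_i$ is the adjacency matrix of $R_i$, $\mathbb A=\mathrm{span}\{A_0,\dots,A_d\}$ is the Bose–Mesner algebra, with primitive idempotents $E_0,\dots,E_d$. The scheme is triply regular if for all $x,y,z\in X$ and all $r,s,t$ the number of $w\in X$ with $(x,w)\in R_r,(y,w)\in R_s,(z,w)\in R_t$ depends only on $r,s,t$ and on the indices $i,j,k$ with $(y,z)\in R_i,(z,x)\in R_j,(x,y)\in R_k$. It is dually triply regular if for all $i,j,k,r,s,t$ there is a scalar $\sigma$ such that for all $x,y,z\in X$: $\sum_{u,v,w\in X}(E_i)_{x,u}(E_j)_{y,v}(E_k)_{z,w}(E_r)_{v,w}(E_s)_{w,u}(E_t)_{u,v}=\sigma\sum_{w'\in X}(E_i)_{x,w'}(E_j)_{y,w'}(E_k)_{z,w'}$. For a graph $G$ and root list $R=(r_1,\dots,r_m)$, $\mathbf W((G,R);\mathbb A)$ is the span of all $\mathsf S(G,R;w)=\sum_{\varphi:V(G)\to X}\big(\prod_{e=ab\in E(G)}w(e)_{\varphi(a),\varphi(b)}\big)\widehat{\varphi(r_1)}\otimes\cdots\otimes\widehat{\varphi(r_m)}$ over $w:E(G)\to\mathbb A$; $\{\hat x\}$ is the standard basis of $\mathbb C^X$. -}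

module Defs where

open import Level using (Level; _⊔_) renaming (suc to lsuc)
open import Data.Nat using (ℕ; zero; suc)
open import Data.Fin using (Fin; zero; suc; _≟_)
open import Data.Bool using (Bool; true; false; if_then_else_; _∧_)
open import Data.Product using (Σ; ∃; ∃-syntax; _×_; _,_)
open import Relation.Nullary using (¬_)
open import Data.Empty using (⊥)
open import Relation.Nullary.Decidable using (⌊_⌋)
open import Relation.Binary.PropositionalEquality using (_≡_)
open import Algebra.Bundles using (CommutativeRing)

record Field (c ℓ : Level) : Set (lsuc (c ⊔ ℓ)) where
  field
    commRing : CommutativeRing c ℓ
  open CommutativeRing commRing public
  field
    0≉1 : ¬ (0# ≈ 1#)
    inverse : ∀ x → ¬ (x ≈ 0#) → ∃[ y ] (x * y ≈ 1#)

module FieldOps {c ℓ} (F : Field c ℓ) where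
  open Field F using (Carrier; _≈_; _+_; _*_; 0#; 1#)

  natF : ℕ → Carrier
  natF zero = 0#
  natF (suc n) = 1# + natF n

  CharZero : Set ℓ
  CharZero = ∀ n → natF (suc n) ≈ 0# → ⊥

  ∑ : ∀ {n} → (Fin n → Carrier) → Carrier
  ∑ {zero} f = 0#
  ∑ {suc n} f = f zero + ∑ (λ i → f (suc i))

  Mat : ℕ → Set c
  Mat n = Fin n → Fin n → Carrier

  _·_ : ∀ {n} → Mat n → Mat n → Mat n
  (M · N) x y = ∑ (λ z → M x z * N z y)

  _⊕_ : ∀ {n} → Mat n → Mat n → Mat n
  (M ⊕ N) x y = M x y + N x y

  I : ∀ {n} → Mat n
  I x y = if ⌊ x ≟ y ⌋ then 1# else 0#

  _≈M_ : ∀ {n} → Mat n → Mat n → Set ℓ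
  M ≈M N = ∀ x y → M x y ≈ N x y

  NonZeroM : ∀ {n} → Mat n → Set ℓ
  NonZeroM M = ∃[ x ] ∃[ y ] ¬ (M x y ≈ 0#)

  -- third tensor power of C^X, as functions X³ → k
  T3 : ℕ → Set c
  T3 n = Fin n → Fin n → Fin n → Carrier

count : ∀ {n} → (Fin n → Bool) → ℕ
count {zero} p = zero
count {suc n} p = (if p zero then suc else (λ m → m)) (count (λ i → p (suc i)))

-- Symmetric association scheme on X = Fin n with classes R_0..R_d,
-- given by the function rel with (x,y) ∈ R_(rel x y).

record SymAssocScheme (n d : ℕ) : Set where
  field
    rel : Fin n → Fin n → Fin (suc d)
    rel-id₁ : ∀ x y → rel x y ≡ zero → x ≡ y
    rel-id₂ : ∀ x → rel x x ≡ zero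
    rel-sym : ∀ x y → rel x y ≡ rel y x
    rel-nonempty : ∀ i → ∃[ x ] ∃[ y ] rel x y ≡ i
    p : Fin (suc d) → Fin (suc d) → Fin (suc d) → ℕ
    p-spec : ∀ i j k a b → rel a b ≡ k →
             count (λ c → ⌊ rel a c ≟ i ⌋ ∧ ⌊ rel c b ≟ j ⌋) ≡ p i j k

module SchemeOps {n d : ℕ} (S : SymAssocScheme n d) where
  open SymAssocScheme S

  TriplyRegular : Set
  TriplyRegular =
    Σ (Fin (suc d) → Fin (suc d) → Fin (suc d) → Fin (suc d) → Fin (suc d) → Fin (suc d) → ℕ) λ q →
    ∀ (x y z : Fin n) (r s t : Fin (suc d)) →
      count (λ w → ⌊ rel x w ≟ r ⌋ ∧ ⌊ rel y w ≟ s ⌋ ∧ ⌊ rel z w ≟ t ⌋)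
        ≡ q r s t (rel y z) (rel z x) (rel x y)

  module Over {c ℓ} (F : Field c ℓ) where
    open Field F using (Carrier; _≈_; _+_; _*_; 0#; 1#)
    open FieldOps F

    A : Fin (suc d) → Mat n
    A i x y = if ⌊ rel x y ≟ i ⌋ then 1# else 0#

    InBM : Mat n → Set (c ⊔ ℓ)
    InBM M = Σ (Fin (suc d) → Carrier) λ a → M ≈M (λ x y → ∑ (λ i → a i * A i x y))

    Idempotent : Mat n → Set (c ⊔ ℓ)
    Idempotent M = InBM M × ((M · M) ≈M M)

    Primitive : Mat n → Set (c ⊔ ℓ)
    Primitive M = Idempotent M × NonZeroM M ×
      (∀ P Q → Idempotent P → Idempotent Q → NonZeroM P → NonZeroM Q →
        (P · Q) ≈M (λ _ _ → 0#) → M ≈M (P ⊕ Q) → ⊥)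

    PrimitiveIdempotents : (Fin (suc d) → Mat n) → Set (c ⊔ ℓ)
    PrimitiveIdempotents E =
      (∀ i → Primitive (E i)) ×
      (∀ i j → E i ≈M E j → i ≡ j) ×
      (∀ M → Primitive M → ∃[ i ] M ≈M E i)

    DuallyTriplyRegular : (Fin (suc d) → Mat n) → Set (c ⊔ ℓ)
    DuallyTriplyRegular E =
      ∀ i j k r s t → Σ Carrier λ σ → ∀ x y z →
        ∑ (λ u → ∑ (λ v → ∑ (λ w →
          E i x u * E j y v * E k z w * E r v w * E s w u * E t u v)))
        ≈ σ * ∑ (λ w' → E i x w' * E j y w' * E k z w')

    -- a rooted diagram with m edges and root list (r₁,r₂,r₃):
    -- edge weights ↦ the tensor S(G,R;w)
    Diagram : ℕ → Set c
    Diagram m = (Fin m → Mat n) → T3 n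

    -- 𝐖((G,R);𝔸) as a predicate on C^X ⊗ C^X ⊗ C^X: finite linear
    -- combinations of S(G,R;w) with all w(e) ∈ 𝔸
    W : ∀ {m} → Diagram m → T3 n → Set (c ⊔ ℓ)
    W {m} D T = Σ ℕ λ N → Σ (Fin N → Carrier) λ coef → Σ (Fin N → Fin m → Mat n) λ ws →
      (∀ j e → InBM (ws j e)) ×
      (∀ x y z → T x y z ≈ ∑ (λ j → coef j * D (ws j) x y z))

    _≡W_ : ∀ {m m'} → Diagram m → Diagram m' → Set (c ⊔ ℓ)
    D ≡W D' = ∀ T → ((W D T → W D' T) × (W D' T → W D T))

    Δ : Diagram 3
    Δ w x y z = w zero x y * w (suc zero) y z * w (suc (suc zero)) z x

    Yd : Diagram 3
    Yd w x y z = ∑ (λ c' → w zero c' x * w (suc zero) c' y * w (suc (suc zero)) c' z)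

    Nd : Diagram 6
    Nd w x y z = ∑ (λ t₁ → ∑ (λ t₂ → ∑ (λ t₃ →
      w zero t₁ t₂ * w (suc zero) t₂ t₃ * w (suc (suc zero)) t₃ t₁ *
      w (suc (suc (suc zero))) x t₁ * w (suc (suc (suc (suc zero)))) y t₂ *
      w (suc (suc (suc (suc (suc zero))))) z t₃)))

    Kd : Diagram 6
    Kd w x y z = ∑ (λ c' →
      w zero x y * w (suc zero) y z * w (suc (suc zero)) z x *
      w (suc (suc (suc zero))) c' x * w (suc (suc (suc (suc zero)))) c' y *
      w (suc (suc (suc (suc (suc zero))))) c' z)

{-# OPTIONS --safe #-}
-- (i) 𝐖(Δ) consists of the tensors whose (x,y,z) entry depends only on the relations between x, y and z,
-- and 𝐖(K) is spanned by products of such tensors with the counts in the definition of triple regularity.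
--
-- (ii) Once the Eᵢ are known to be a basis of orthogonal idempotents of 𝔸, the star tensors with edges
-- labelled Eᵢ, Eⱼ, Eₖ span 𝐖(Y), and they lie in the images of the mutually orthogonal projections
-- Eᵢ ⊗ Eⱼ ⊗ Eₖ. The left-hand side of dual triple regularity is a generator of 𝐖(N) in the image of such
-- a projection, so it lies in 𝐖(Y) precisely when it is a multiple of the corresponding star.
--
-- Equality in the field is not assumed decidable or even ¬¬-stable. Classical linear algebra therefore
-- yields orthogonality and spanning of the Eᵢ only up to double negation; in both cases the defect is an
-- idempotent matrix, which vanishes by Nakayama's lemma.
module Submission where

open import Defs
open import Level using (_⊔_)
open import Data.Nat using (ℕ; zero; suc)
open import Data.Fin using (Fin; zero; suc; _≟_; punchIn)
open import Data.Fin.Properties using (punchInᵢ≢i; any?)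
open import Data.Bool using (Bool; true; false; if_then_else_; _∧_)
open import Data.Product using (Σ; ∃-syntax; _×_; _,_; proj₁; proj₂)
open import Data.Empty using (⊥-elim)
open import Data.Vec.Functional using (insertAt)
open import Data.Vec.Functional.Properties using (insertAt-lookup; insertAt-punchIn)
open import Function.Bundles using (_⇔_; mk⇔)
open import Relation.Nullary using (¬_; Dec; yes; no)
open import Relation.Nullary.Decidable using (⌊_⌋; _×-dec_)
open import Relation.Binary.PropositionalEquality as ≡ using (_≡_; _≢_)
import Algebra.Properties.Group
import Algebra.Properties.Ring
import Algebra.Properties.Semiring.Sum
import Algebra.Solver.Ring.NaturalCoefficients.Default
import Relation.Binary.Reasoning.Setoid

-- Finite sets

-- Used for the positivity of valencies, which characteristic zero then carries over to the field.
count-suc : ∀ {n} (p : Fin n → Bool) i → p i ≡ true → ∃[ m ] count p ≡ suc m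
count-suc p zero eq rewrite eq = _ , ≡.refl
count-suc p (suc i) eq with p zero | count-suc (λ j → p (suc j)) i eq
... | true | _ = _ , ≡.refl
... | false | m , eq' = m , eq'

⌊≟⌋-refl : ∀ {n} (i : Fin n) → ⌊ i ≟ i ⌋ ≡ true
⌊≟⌋-refl i with i ≟ i
... | yes _ = ≡.refl
... | no i≢i = ⊥-elim (i≢i ≡.refl)

pattern #0 = zero
pattern #1 = suc zero
pattern #2 = suc (suc zero)
pattern #3 = suc (suc (suc zero))
pattern #4 = suc (suc (suc (suc zero)))
pattern #5 = suc (suc (suc (suc (suc zero))))

vec₃ : ∀ {a} {A : Set a} → A → A → A → Fin 3 → A
vec₃ a₀ a₁ a₂ = λ { #0 → a₀ ; #1 → a₁ ; #2 → a₂ }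

vec₆ : ∀ {a} {A : Set a} → A → A → A → A → A → A → Fin 6 → A
vec₆ a₀ a₁ a₂ a₃ a₄ a₅ = λ { #0 → a₀ ; #1 → a₁ ; #2 → a₂ ; #3 → a₃ ; #4 → a₄ ; #5 → a₅ }

-- Finiteness of the index set is essential: the double negations are opened one index at a time.
¬¬-∀ : ∀ {a n} {P : Fin n → Set a} → (∀ i → ¬ ¬ P i) → ¬ ¬ (∀ i → P i)
¬¬-∀ {n = zero} h k = k (λ ())
¬¬-∀ {n = suc n} h k =
  h zero (λ p₀ → ¬¬-∀ (λ i → h (suc i)) (λ ps → k (λ { zero → p₀ ; (suc i) → ps i })))

module LinearAlgebra {c ℓ} (F : Field c ℓ) where
  open Field F hiding (zero)
  open FieldOps F
  open Algebra.Properties.Ring ring using (-0#≈0#; -‿+-comm; -‿distribˡ-*; -‿distribʳ-*)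
  open Algebra.Properties.Group +-group using (inverseˡ-unique) renaming (∙-cancelˡ to +-cancelˡ)
  open Relation.Binary.Reasoning.Setoid setoid
  open Algebra.Solver.Ring.NaturalCoefficients.Default commutativeSemiring
    using (solve; _:+_; _:*_; _:=_)
  private module Sum = Algebra.Properties.Semiring.Sum semiring

  -- Finite sums

  ∑≈sum : ∀ {n} (f : Fin n → Carrier) → ∑ f ≈ Sum.sum f
  ∑≈sum {zero} f = refl
  ∑≈sum {suc n} f = +-congˡ (∑≈sum (λ i → f (suc i)))

  ∑-cong : ∀ {n} {f g : Fin n → Carrier} → (∀ i → f i ≈ g i) → ∑ f ≈ ∑ g
  ∑-cong {zero} h = refl
  ∑-cong {suc n} h = +-cong (h zero) (∑-cong (λ i → h (suc i)))

  ∑-zero : ∀ {n} {f : Fin n → Carrier} → (∀ i → f i ≈ 0#) → ∑ f ≈ 0#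
  ∑-zero {zero} h = refl
  ∑-zero {suc n} h = trans (+-cong (h zero) (∑-zero (λ i → h (suc i)))) (+-identityˡ 0#)

  ∑-+ : ∀ {n} (f g : Fin n → Carrier) → ∑ (λ i → f i + g i) ≈ ∑ f + ∑ g
  ∑-+ f g = trans (∑≈sum (λ i → f i + g i))
    (trans (Sum.∑-distrib-+ f g) (sym (+-cong (∑≈sum f) (∑≈sum g))))

  *-∑ : ∀ {n} x (f : Fin n → Carrier) → x * ∑ f ≈ ∑ (λ i → x * f i)
  *-∑ x f = trans (*-congˡ (∑≈sum f))
    (trans (Sum.*-distribˡ-sum x f) (sym (∑≈sum (λ i → x * f i))))

  ∑-* : ∀ {n} x (f : Fin n → Carrier) → ∑ f * x ≈ ∑ (λ i → f i * x)
  ∑-* x f = trans (*-congʳ (∑≈sum f))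
    (trans (Sum.*-distribʳ-sum x f) (sym (∑≈sum (λ i → f i * x))))

  ∑-swap : ∀ {m n} (f : Fin m → Fin n → Carrier) →
           ∑ (λ i → ∑ (λ j → f i j)) ≈ ∑ (λ j → ∑ (λ i → f i j))
  ∑-swap {m} {n} f = trans (double f) (trans (Sum.∑-comm f) (sym (double (λ j i → f i j))))
    where
    double : ∀ {m n} (f : Fin m → Fin n → Carrier) →
             ∑ (λ i → ∑ (λ j → f i j)) ≈ Sum.sum (λ i → Sum.sum (f i))
    double f = trans (∑-cong (λ i → ∑≈sum (f i))) (∑≈sum (λ i → Sum.sum (f i)))

  ∑-punchIn : ∀ {n} i (f : Fin (suc n) → Carrier) → ∑ f ≈ f i + ∑ (λ j → f (punchIn i j))
  ∑-punchIn i f = trans (∑≈sum f)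
    (trans (Sum.sum-remove {i = i} f) (+-congˡ (sym (∑≈sum (λ j → f (punchIn i j))))))

  ∑-single : ∀ {n} i (f : Fin n → Carrier) → (∀ j → j ≢ i → f j ≈ 0#) → ∑ f ≈ f i
  ∑-single {suc n} i f h = begin
    ∑ f                               ≈⟨ ∑-punchIn i f ⟩
    f i + ∑ (λ j → f (punchIn i j))   ≈⟨ +-congˡ (∑-zero (λ j → h _ (punchInᵢ≢i i j))) ⟩
    f i + 0#                          ≈⟨ +-identityʳ _ ⟩
    f i                               ∎

  -- A row vector times a matrix times a column vector. This serves both the associativity of matrix
  -- products and every change of basis below.
  ∑-assoc : ∀ {m n} (a : Fin m → Carrier) (b : Fin m → Fin n → Carrier) (f : Fin n → Carrier) →
            ∑ (λ j → ∑ (λ i → a i * b i j) * f j) ≈ ∑ (λ i → a i * ∑ (λ j → b i j * f j))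
  ∑-assoc {m} {n} a b f = begin
    ∑ (λ j → ∑ (λ i → a i * b i j) * f j)     ≈⟨ ∑-cong {n} (λ j → ∑-* {m} _ _) ⟩
    ∑ (λ j → ∑ (λ i → a i * b i j * f j))     ≈⟨ ∑-swap {n} {m} _ ⟩
    ∑ (λ i → ∑ (λ j → a i * b i j * f j))     ≈⟨ ∑-cong {m} (λ i → ∑-cong {n} (λ j → *-assoc _ _ _)) ⟩
    ∑ (λ i → ∑ (λ j → a i * (b i j * f j)))   ≈⟨ ∑-cong {m} (λ i → *-∑ {n} _ _) ⟨
    ∑ (λ i → a i * ∑ (λ j → b i j * f j))     ∎

  ∑-neg : ∀ {n} (f : Fin n → Carrier) → ∑ (λ i → - f i) ≈ - ∑ f
  ∑-neg {zero} f = sym -0#≈0#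
  ∑-neg {suc n} f = trans (+-congˡ (∑-neg (λ i → f (suc i)))) (-‿+-comm _ _)

  ∑-minus : ∀ {n} (f g : Fin n → Carrier) → ∑ (λ i → f i - g i) ≈ ∑ f - ∑ g
  ∑-minus f g = trans (∑-+ f (λ i → - g i)) (+-congˡ (∑-neg g))

  𝟙 : Bool → Carrier
  𝟙 b = if b then 1# else 0#

  𝟙-≡ : ∀ {n} {i j : Fin n} → i ≡ j → 𝟙 ⌊ i ≟ j ⌋ ≈ 1#
  𝟙-≡ {i = i} {j} eq with i ≟ j
  ... | yes _ = refl
  ... | no ne = ⊥-elim (ne eq)

  𝟙-≢ : ∀ {n} {i j : Fin n} → i ≢ j → 𝟙 ⌊ i ≟ j ⌋ ≈ 0#
  𝟙-≢ {i = i} {j} ne with i ≟ j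
  ... | yes eq = ⊥-elim (ne eq)
  ... | no _ = refl

  𝟙-sym : ∀ {n} (i j : Fin n) → 𝟙 ⌊ i ≟ j ⌋ ≈ 𝟙 ⌊ j ≟ i ⌋
  𝟙-sym i j with j ≟ i
  ... | yes j≡i = 𝟙-≡ (≡.sym j≡i)
  ... | no j≢i = 𝟙-≢ (λ i≡j → j≢i (≡.sym i≡j))

  𝟙-∧ : ∀ a b → 𝟙 (a ∧ b) ≈ 𝟙 a * 𝟙 b
  𝟙-∧ true b = sym (*-identityˡ _)
  𝟙-∧ false b = sym (zeroˡ _)

  ∑-𝟙 : ∀ {n} i (f : Fin n → Carrier) → ∑ (λ j → f j * 𝟙 ⌊ i ≟ j ⌋) ≈ f i
  ∑-𝟙 i f = trans
    (∑-single i _ (λ j j≢i → trans (*-congˡ (𝟙-≢ (λ i≡j → j≢i (≡.sym i≡j)))) (zeroʳ _)))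
    (trans (*-congˡ (𝟙-≡ ≡.refl)) (*-identityʳ _))

  natF-count : ∀ {n} (p : Fin n → Bool) → natF (count p) ≈ ∑ (λ i → 𝟙 (p i))
  natF-count {zero} p = refl
  natF-count {suc n} p with p zero
  ... | true = +-congˡ (natF-count (λ i → p (suc i)))
  ... | false = trans (natF-count (λ i → p (suc i))) (sym (+-identityˡ _))

  -- Sorts the indices `z` by the pair `(r z , s z)`. With `r` and `s` taken from the relations of a
  -- scheme, the counts become intersection numbers.
  ∑-by-class : ∀ {n e} (r s : Fin n → Fin e) (f g : Fin e → Carrier) →
    ∑ (λ z → f (r z) * g (s z)) ≈
    ∑ (λ i → ∑ (λ j → f i * g j * natF (count (λ z → ⌊ r z ≟ i ⌋ ∧ ⌊ s z ≟ j ⌋))))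
  ∑-by-class {n} {e} r s f g = begin
    ∑ (λ z → f (r z) * g (s z))
      ≈⟨ ∑-cong {n} (λ z → *-cong (∑-𝟙 (r z) f) (∑-𝟙 (s z) g)) ⟨
    ∑ (λ z → ∑ (λ i → f i * 𝟙 ⌊ r z ≟ i ⌋) * ∑ (λ j → g j * 𝟙 ⌊ s z ≟ j ⌋))
      ≈⟨ ∑-cong {n} (λ z → trans (∑-* {e} _ _) (∑-cong {e} (λ i → *-∑ {e} _ _))) ⟩
    ∑ (λ z → ∑ (λ i → ∑ (λ j → f i * 𝟙 ⌊ r z ≟ i ⌋ * (g j * 𝟙 ⌊ s z ≟ j ⌋))))
      ≈⟨ trans (∑-swap {n} {e} _) (∑-cong {e} (λ i → ∑-swap {n} {e} _)) ⟩
    ∑ (λ i → ∑ (λ j → ∑ (λ z → f i * 𝟙 ⌊ r z ≟ i ⌋ * (g j * 𝟙 ⌊ s z ≟ j ⌋))))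
      ≈⟨ ∑-cong {e} (λ i → ∑-cong {e} (λ j → ∑-cong {n} (λ z → regroup i j z))) ⟩
    ∑ (λ i → ∑ (λ j → ∑ (λ z → f i * g j * 𝟙 (⌊ r z ≟ i ⌋ ∧ ⌊ s z ≟ j ⌋))))
      ≈⟨ ∑-cong {e} (λ i → ∑-cong {e} (λ j → trans (*-congˡ (natF-count {n} _)) (*-∑ {n} _ _))) ⟨
    ∑ (λ i → ∑ (λ j → f i * g j * natF (count (λ z → ⌊ r z ≟ i ⌋ ∧ ⌊ s z ≟ j ⌋)))) ∎
    where
    regroup : ∀ i j z → f i * 𝟙 ⌊ r z ≟ i ⌋ * (g j * 𝟙 ⌊ s z ≟ j ⌋) ≈
              f i * g j * 𝟙 (⌊ r z ≟ i ⌋ ∧ ⌊ s z ≟ j ⌋)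
    regroup i j z = trans
      (solve 4 (λ a b c d → a :* b :* (c :* d) := a :* c :* (b :* d)) refl _ _ _ _)
      (*-congˡ (sym (𝟙-∧ ⌊ r z ≟ i ⌋ ⌊ s z ≟ j ⌋)))

  x-x≈0 : ∀ {x y} → x ≈ y → x - y ≈ 0#
  x-x≈0 x≈y = trans (+-congʳ x≈y) (-‿inverseʳ _)

  -‿cancel : ∀ x y → y + (x - y) ≈ x
  -‿cancel x y = begin
    y + (x - y)     ≈⟨ solve 3 (λ x y z → y :+ (x :+ z) := x :+ (y :+ z)) refl x y (- y) ⟩
    x + (y - y)     ≈⟨ +-congˡ (-‿inverseʳ y) ⟩
    x + 0#          ≈⟨ +-identityʳ x ⟩
    x               ∎

  minus-0 : ∀ x → x - 0# ≈ x
  minus-0 x = trans (+-congˡ -0#≈0#) (+-identityʳ x)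

  x-y≈0⇒x≈y : ∀ {x y} → x - y ≈ 0# → x ≈ y
  x-y≈0⇒x≈y {x} {y} h = trans (sym (-‿cancel x y)) (trans (+-congˡ h) (+-identityʳ y))

  *-distribˡ-minus : ∀ x y z → x * (y - z) ≈ x * y - x * z
  *-distribˡ-minus x y z = trans (distribˡ x y (- z)) (+-congˡ (sym (-‿distribʳ-* x z)))

  *-distribʳ-minus : ∀ x y z → (y - z) * x ≈ y * x - z * x
  *-distribʳ-minus x y z = trans (distribʳ x y (- z)) (+-congˡ (sym (-‿distribˡ-* z x)))

  minus-cong : ∀ {x x' y y'} → x ≈ x' → y ≈ y' → x - y ≈ x' - y'
  minus-cong p q = +-cong p (-‿cong q)

  *-cancelˡ-0 : ∀ {x y} → ¬ (x ≈ 0#) → x * y ≈ 0# → y ≈ 0#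
  *-cancelˡ-0 {x} {y} x≉0 xy≈0 = begin
    y             ≈⟨ *-identityˡ y ⟨
    1# * y        ≈⟨ *-congʳ (proj₂ (inverse x x≉0)) ⟨
    x * u * y     ≈⟨ solve 3 (λ a b c → a :* b :* c := b :* (a :* c)) refl x u y ⟩
    u * (x * y)   ≈⟨ *-congˡ xy≈0 ⟩
    u * 0#        ≈⟨ zeroʳ u ⟩
    0#            ∎
    where u = proj₁ (inverse x x≉0)

  -- Equality in F need not be stable under double negation, but elements that are not nonzero form
  -- an ideal contained in the Jacobson radical.
  Near0 : Carrier → Set ℓ
  Near0 x = ¬ ¬ (x ≈ 0#)

  Near0-+ : ∀ {x y} → Near0 x → Near0 y → Near0 (x + y)
  Near0-+ hx hy k = hx (λ x≈0 → hy (λ y≈0 → k (trans (+-cong x≈0 y≈0) (+-identityˡ 0#))))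

  Near0-* : ∀ x {y} → Near0 y → Near0 (x * y)
  Near0-* x hy k = hy (λ y≈0 → k (trans (*-congˡ y≈0) (zeroʳ x)))

  -- If `1# - x` vanished, `x` would be `1#`, which cannot be `Near0` because `0≉1`.
  1-Near0-invertible : ∀ {x} → Near0 x → ∃[ y ] ((1# - x) * y ≈ 1#)
  1-Near0-invertible {x} hx = inverse (1# - x)
    (λ eq → hx (λ x≈0 → 0≉1 (trans (sym x≈0) (sym (x-y≈0⇒x≈y eq)))))

  -- Gaussian elimination on `1 - Z`: the pivot is invertible by `1-Near0-invertible`, so the first
  -- unknown can be eliminated without any case distinction.
  nakayama : ∀ {m} (Z : Mat m) (v : Fin m → Carrier) → (∀ i j → Near0 (Z i j)) →
             (∀ i → v i ≈ ∑ (λ j → Z i j * v j)) → ∀ i → v i ≈ 0#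
  nakayama {suc m} Z v near fix = λ { zero → v₀≈0 ; (suc i) → tail≈0 i }
    where
    z = Z zero zero
    u = proj₁ (1-Near0-invertible (near zero zero))
    u-inv : (1# - z) * u ≈ 1#
    u-inv = proj₂ (1-Near0-invertible (near zero zero))
    rest = ∑ (λ j → Z zero (suc j) * v (suc j))
    pivot : (1# - z) * v zero ≈ rest
    pivot = begin
      (1# - z) * v zero               ≈⟨ *-distribʳ-minus _ _ _ ⟩
      1# * v zero - z * v zero        ≈⟨ +-congʳ (trans (*-identityˡ _) (fix zero)) ⟩
      z * v zero + rest - z * v zero  ≈⟨ +-assoc _ _ _ ⟩
      z * v zero + (rest - z * v zero) ≈⟨ -‿cancel rest (z * v zero) ⟩
      rest                            ∎
    v₀ : v zero ≈ u * rest
    v₀ = begin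
      v zero                    ≈⟨ *-identityˡ _ ⟨
      1# * v zero               ≈⟨ *-congʳ u-inv ⟨
      (1# - z) * u * v zero     ≈⟨ solve 3 (λ a b c → a :* b :* c := b :* (a :* c)) refl (1# - z) u (v zero) ⟩
      u * ((1# - z) * v zero)   ≈⟨ *-congˡ pivot ⟩
      u * rest                  ∎
    -- The system left after substituting `v₀`. The correction term is a multiple of a `Near0`
    -- entry, so the hypothesis on `Z` survives.
    Z' : Mat m
    Z' i j = Z (suc i) zero * u * Z zero (suc j) + Z (suc i) (suc j)
    fix' : ∀ i → v (suc i) ≈ ∑ (λ j → Z' i j * v (suc j))
    fix' i = begin
      v (suc i)
        ≈⟨ fix (suc i) ⟩
      Z (suc i) zero * v zero + ∑ (λ j → Z (suc i) (suc j) * v (suc j))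
        ≈⟨ +-congʳ (trans (*-congˡ v₀) (trans (sym (*-assoc _ _ _)) (*-∑ {m} _ _))) ⟩
      ∑ (λ j → Z (suc i) zero * u * (Z zero (suc j) * v (suc j))) + ∑ (λ j → Z (suc i) (suc j) * v (suc j))
        ≈⟨ ∑-+ {m} _ _ ⟨
      ∑ (λ j → Z (suc i) zero * u * (Z zero (suc j) * v (suc j)) + Z (suc i) (suc j) * v (suc j))
        ≈⟨ ∑-cong {m} (λ j → trans (+-congʳ (sym (*-assoc _ _ _))) (sym (distribʳ _ _ _))) ⟩
      ∑ (λ j → Z' i j * v (suc j)) ∎
    tail≈0 : ∀ i → v (suc i) ≈ 0#
    tail≈0 = nakayama Z' (λ i → v (suc i))
      (λ i j → Near0-+ (Near0-* _ (near zero (suc j))) (near (suc i) (suc j))) fix'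
    v₀≈0 : v zero ≈ 0#
    v₀≈0 = trans v₀ (trans (*-congˡ (∑-zero (λ j → trans (*-congˡ (tail≈0 j)) (zeroʳ _)))) (zeroʳ u))

  -- Linear dependence

  Dependent : ∀ {m n} → (Fin m → Fin n → Carrier) → Set (c ⊔ ℓ)
  Dependent {m} v = Σ (Fin m → Carrier) λ a →
    (∃[ i ] ¬ (a i ≈ 0#)) × (∀ l → ∑ (λ i → a i * v i l) ≈ 0#)

  ∑-combine : ∀ {m} (a b y : Fin m → Carrier) x →
              ∑ (λ j → a j * b j) * x + ∑ (λ j → a j * y j) ≈ ∑ (λ j → a j * (b j * x + y j))
  ∑-combine {m} a b y x = begin
    ∑ (λ j → a j * b j) * x + ∑ (λ j → a j * y j)        ≈⟨ +-congʳ (∑-* {m} _ _) ⟩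
    ∑ (λ j → a j * b j * x) + ∑ (λ j → a j * y j)        ≈⟨ ∑-+ {m} _ _ ⟨
    ∑ (λ j → a j * b j * x + a j * y j)
      ≈⟨ ∑-cong {m} (λ j → trans (+-congʳ (*-assoc _ _ _)) (sym (distribˡ _ _ _))) ⟩
    ∑ (λ j → a j * (b j * x + y j))                      ∎

  -- Gaussian elimination, weakened because no pivot can be found by deciding equality. If there
  -- were no dependence, no vector could have a nonzero first coordinate, since it would serve as a
  -- pivot; hence, up to double negation, the first column vanishes, and then a dependence exists
  -- after all.
  dependent : ∀ n (v : Fin (suc n) → Fin n → Carrier) → ¬ ¬ Dependent v
  dependent zero v k = k ((λ _ → 1#) , (zero , λ 1≈0 → 0≉1 (sym 1≈0)) , λ ())
  dependent (suc n) v k = ¬¬-∀ (λ i v≉0 → eliminate i v≉0) all-zero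
    where
    extend : ∀ {m} → (Fin m → Carrier) → Fin (suc m) → Carrier
    extend a zero = 0#
    extend a (suc i) = a i
    -- With the first column zero, one vector can be spared: it receives the coefficient `0#`, and
    -- the others are one too many for the remaining coordinates.
    all-zero : ¬ (∀ i → v i zero ≈ 0#)
    all-zero v≈0 = dependent n (λ i l → v (suc i) (suc l)) (λ { (a , (i , aᵢ≉0) , rel) → k
      ( extend a
      , (suc i , aᵢ≉0)
      , (λ { zero → ∑-zero (λ i → trans (*-congˡ {extend a i} (v≈0 i)) (zeroʳ _))
           ; (suc l) → trans (+-cong (zeroˡ _) (rel l)) (+-identityˡ 0#) })) })
    eliminate : ∀ i → ¬ ¬ (v i zero ≈ 0#)
    eliminate i v≉0 = dependent n (λ j l → w j (suc l)) (λ { (a , (j , aⱼ≉0) , rel) →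
      -- A relation among the reduced vectors `w j` becomes one among the original vectors when the
      -- pivot `v i` receives the accumulated multipliers `s`.
      let s = ∑ (λ j → a j * m j)
          a' = insertAt a i s
          w-rel : ∀ l → ∑ (λ j → a j * w j l) ≈ 0#
          w-rel = λ { zero → ∑-zero (λ j → trans (*-congˡ {a j} (w₀ j)) (zeroʳ _)) ; (suc l) → rel l }
      in k
      ( a'
      , (punchIn i j , λ e → aⱼ≉0 (trans (reflexive (≡.sym (insertAt-punchIn a i s j))) e))
      , λ l → begin
          ∑ (λ i → a' i * v i l)
            ≈⟨ ∑-punchIn i (λ i → a' i * v i l) ⟩
          a' i * v i l + ∑ (λ j → a' (punchIn i j) * v (punchIn i j) l)
            ≈⟨ +-cong (*-congʳ (reflexive (insertAt-lookup a i s)))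
                      (∑-cong (λ j → *-congʳ {v (punchIn i j) l} (reflexive (insertAt-punchIn a i s j)))) ⟩
          s * v i l + ∑ (λ j → a j * v (punchIn i j) l)
            ≈⟨ ∑-combine a m (λ j → v (punchIn i j) l) (v i l) ⟩
          ∑ (λ j → a j * w j l)
            ≈⟨ w-rel l ⟩
          0# ∎) })
      where
      u = proj₁ (inverse (v i zero) v≉0)
      -- The multiple of the pivot vector that clears the first coordinate of `v (punchIn i j)`.
      m : Fin (suc n) → Carrier
      m j = - (v (punchIn i j) zero * u)
      w : Fin (suc n) → Fin (suc n) → Carrier
      w j l = m j * v i l + v (punchIn i j) l
      w₀ : ∀ j → w j zero ≈ 0#
      w₀ j = begin
        - (x * u) * v i zero + x     ≈⟨ +-congʳ (sym (-‿distribˡ-* _ _)) ⟩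
        - (x * u * v i zero) + x     ≈⟨ +-congʳ (-‿cong (trans (*-assoc _ _ _) (trans (*-congˡ (trans (*-comm _ _)
                                          (proj₂ (inverse (v i zero) v≉0)))) (*-identityʳ _)))) ⟩
        - x + x                      ≈⟨ -‿inverseˡ x ⟩
        0#                           ∎
        where x = v (punchIn i j) zero

  -- Matrices

  _⊖_ : ∀ {n} → Mat n → Mat n → Mat n
  (M ⊖ N) x y = M x y - N x y

  module _ {n : ℕ} where

    ·-congˡ : ∀ {M N N' : Mat n} → N ≈M N' → (M · N) ≈M (M · N')
    ·-congˡ q x y = ∑-cong (λ z → *-congˡ (q z y))

    ·-congʳ : ∀ {M M' N : Mat n} → M ≈M M' → (M · N) ≈M (M' · N)
    ·-congʳ p x y = ∑-cong (λ z → *-congʳ (p x z))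

    ·-assoc : ∀ (L M N : Mat n) → ((L · M) · N) ≈M (L · (M · N))
    ·-assoc L M N x y = ∑-assoc (L x) M (λ z → N z y)

    ·-distribˡ-⊖ : ∀ (L M N : Mat n) → (L · (M ⊖ N)) ≈M ((L · M) ⊖ (L · N))
    ·-distribˡ-⊖ L M N x y = trans (∑-cong {n} (λ z → *-distribˡ-minus _ _ _)) (∑-minus {n} _ _)

    ·-distribʳ-⊖ : ∀ (L M N : Mat n) → ((M ⊖ N) · L) ≈M ((M · L) ⊖ (N · L))
    ·-distribʳ-⊖ L M N x y = trans (∑-cong {n} (λ z → *-distribʳ-minus _ _ _)) (∑-minus {n} _ _)

    -- Idempotency says that every column of `P` is fixed by `P`, which is the fixed-point equation
    -- of `nakayama` with `P` as the matrix.
    idempotent-Near0 : ∀ {P : Mat n} → (P · P) ≈M P → (∀ x y → Near0 (P x y)) → P ≈M (λ _ _ → 0#)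
    idempotent-Near0 {P} idem near x y =
      nakayama P (λ x → P x y) near (λ x → sym (idem x y)) x

  comb : ∀ {m n} → (Fin m → Carrier) → (Fin m → Mat n) → Mat n
  comb a B x y = ∑ (λ i → a i * B i x y)

  comb-· : ∀ {m n} (a : Fin m → Carrier) (B : Fin m → Mat n) (M : Mat n) →
           (comb a B · M) ≈M comb a (λ i → B i · M)
  comb-· a B M x y = ∑-assoc a (λ i z → B i x z) (λ z → M z y)

  -- E₁, …, Eₑ are orthogonal idempotents in the span of the adjacency matrices of e classes. Writing
  -- E = Q A, the coefficients of A in terms of E must be P k j = (Aₖ Eⱼ)ₓₓ / (Eⱼ)ₓₓ. Then Q P = 1 holds
  -- outright, whereas P Q = 1 holds a priori only up to double negation; but 1 − P Q is idempotent, so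
  -- Nakayama's lemma removes the double negation.
  module Spectral (char0 : CharZero) {n e : ℕ} (rel : Fin n → Fin n → Fin e)
    (rel-sym : ∀ x y → rel x y ≡ rel y x) (rel-nonempty : ∀ k → ∃[ x ] ∃[ y ] rel x y ≡ k)
    (E : Fin e → Mat n) (q : Fin e → Fin e → Carrier) (E-val : ∀ i x y → E i x y ≈ q i (rel x y))
    (idem : ∀ i → (E i · E i) ≈M E i) (orth : ∀ i j → i ≢ j → (E i · E j) ≈M (λ _ _ → 0#))
    (nonzero : ∀ i → NonZeroM (E i)) where

    adj : Fin e → Mat n
    adj k x y = 𝟙 ⌊ rel x y ≟ k ⌋

    E-adj : ∀ i → comb (q i) adj ≈M E i
    E-adj i x y = trans (∑-𝟙 (rel x y) (q i)) (sym (E-val i x y))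

    comb-·-E : ∀ a j x y → (comb a E · E j) x y ≈ a j * E j x y
    comb-·-E a j x y = begin
      (comb a E · E j) x y                 ≈⟨ comb-· a E (E j) x y ⟩
      ∑ (λ i → a i * (E i · E j) x y)      ≈⟨ ∑-single {e} j _ (λ i i≢j → trans (*-congˡ (orth i j i≢j x y)) (zeroʳ _)) ⟩
      a j * (E j · E j) x y                ≈⟨ *-congˡ (idem j x y) ⟩
      a j * E j x y                        ∎

    -- Multiplying the relation by `E j` isolates the term `a j * E j x y`, and some entry of `E j`
    -- can be cancelled.
    E-independent : ∀ a → comb a E ≈M (λ _ _ → 0#) → ∀ j → a j ≈ 0#
    E-independent a eq j with nonzero j
    ... | x , y , Exy≉0 = *-cancelˡ-0 Exy≉0 (begin
      E j x y * a j              ≈⟨ *-comm _ _ ⟩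
      a j * E j x y              ≈⟨ comb-·-E a j x y ⟨
      (comb a E · E j) x y       ≈⟨ ∑-zero {n} (λ z → trans (*-congʳ (eq x z)) (zeroˡ _)) ⟩
      0#                         ∎)

    -- A dimension count: `adj k` and the `e` matrices `E i` live in a space of dimension `e`, so
    -- they are dependent. The coefficient of `adj k` cannot vanish, as that would leave a
    -- nontrivial relation among the independent `E i`; dividing by it gives the expansion.
    adj-expand-¬¬ : ∀ k → ¬ ¬ (∃[ a ] adj k ≈M comb a E)
    adj-expand-¬¬ k no-expansion = dependent e vectors λ { (a , nontrivial , relation) →
      let b : Fin e → Carrier
          b i = a (suc i)
          matrix-relation : ∀ x y → a zero * adj k x y + comb b E x y ≈ 0#
          matrix-relation x y = trans (+-congˡ (∑-cong {e} (λ i → *-congˡ (E-val i x y)))) (relation (rel x y))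
          a₀≉0 : ¬ (a zero ≈ 0#)
          a₀≉0 a₀≈0 = trivial a nontrivial a₀≈0 (E-independent b (λ x y → begin
            comb b E x y                        ≈⟨ +-identityˡ _ ⟨
            0# + comb b E x y                   ≈⟨ +-congʳ (trans (*-congʳ a₀≈0) (zeroˡ _)) ⟨
            a zero * adj k x y + comb b E x y   ≈⟨ matrix-relation x y ⟩
            0#                                  ∎))
          u = proj₁ (inverse (a zero) a₀≉0)
      in no-expansion ((λ i → - u * b i) , λ x y → begin
        adj k x y             ≈⟨ inverseˡ-unique _ _ (begin
          adj k x y + u * comb b E x y
            ≈⟨ +-congʳ (trans (*-congʳ (trans (*-comm _ _) (proj₂ (inverse (a zero) a₀≉0)))) (*-identityˡ _)) ⟨
          u * a zero * adj k x y + u * comb b E x y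
            ≈⟨ trans (+-congʳ (*-assoc _ _ _)) (sym (distribˡ _ _ _)) ⟩
          u * (a zero * adj k x y + comb b E x y)
            ≈⟨ trans (*-congˡ (matrix-relation x y)) (zeroʳ u) ⟩
          0# ∎) ⟩
        - (u * comb b E x y)  ≈⟨ -‿distribˡ-* _ _ ⟩
        - u * comb b E x y    ≈⟨ *-∑ {e} _ _ ⟩
        ∑ (λ i → - u * (b i * E i x y))  ≈⟨ ∑-cong {e} (λ i → sym (*-assoc _ _ _)) ⟩
        comb (λ i → - u * b i) E x y ∎) }
      where
      -- Coordinates are the values on the `e` classes.
      vectors : Fin (suc e) → Fin e → Carrier
      vectors zero l = 𝟙 ⌊ l ≟ k ⌋
      vectors (suc i) l = q i l
      trivial : ∀ (a : Fin (suc e) → Carrier) → (∃[ i ] ¬ (a i ≈ 0#)) → a zero ≈ 0# → ¬ (∀ i → a (suc i) ≈ 0#)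
      trivial a (zero , a₀≉0) a₀≈0 _ = a₀≉0 a₀≈0
      trivial a (suc i , aᵢ≉0) _ b≈0 = aᵢ≉0 (b≈0 i)

    -- The row of a known nonzero entry of `E j`, which is the point at which `diag≉0` argues.
    base : Fin e → Fin n
    base j = proj₁ (nonzero j)

    diag : Fin e → Carrier
    diag j = E j (base j) (base j)

    -- If the diagonal of Eⱼ vanished, so would that of every Aₖ Eⱼ; but for k = rel x y the latter is
    -- (Eⱼ)ₓᵧ times the valency of the class k.
    diag≉0 : ∀ j → ¬ (diag j ≈ 0#)
    diag≉0 j diag≈0 with nonzero j
    ... | x , y , Exy≉0 = adj-expand-¬¬ k λ { (a , expand) →
      Exy≉0 (*-cancelˡ-0 valency≉0 (begin
        natF (count neighbour) * E j x y
          ≈⟨ trans (*-congʳ (natF-count neighbour)) (∑-* {n} _ _) ⟩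
        ∑ (λ z → adj k x z * E j x y)
          ≈⟨ ∑-cong {n} entry ⟩
        (adj k · E j) x x
          ≈⟨ ·-congʳ {N = E j} expand x x ⟩
        (comb a E · E j) x x
          ≈⟨ comb-·-E a j x x ⟩
        a j * E j x x
          ≈⟨ trans (*-congˡ diag≈0) (zeroʳ _) ⟩
        0# ∎)) }
      where
      k = rel x y
      neighbour : Fin n → Bool
      neighbour z = ⌊ rel x z ≟ k ⌋
      valency≉0 : ¬ (natF (count neighbour) ≈ 0#)
      valency≉0 with count neighbour | count-suc neighbour y (⌊≟⌋-refl k)
      ... | _ | m , ≡.refl = char0 m
      -- Where `adj k x z` is nonzero, symmetry puts `(z , x)` in the same class as `(x , y)`, so
      -- `E j` takes the same value on both.
      entry : ∀ z → adj k x z * E j x y ≈ adj k x z * E j z x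
      entry z with rel x z ≟ k
      ... | yes eq = *-congˡ (begin
        E j x y         ≈⟨ E-val j x y ⟩
        q j k           ≡⟨ ≡.cong (q j) (≡.trans (≡.sym eq) (rel-sym x z)) ⟩
        q j (rel z x)   ≈⟨ E-val j z x ⟨
        E j z x         ∎)
      ... | no _ = trans (zeroˡ _) (sym (zeroˡ _))

    diag⁻¹ : Fin e → Carrier
    diag⁻¹ j = proj₁ (inverse (diag j) (diag≉0 j))

    diag-inverse : ∀ j → diag j * diag⁻¹ j ≈ 1#
    diag-inverse j = proj₂ (inverse (diag j) (diag≉0 j))

    P : Fin e → Fin e → Carrier
    P k j = (adj k · E j) (base j) (base j) * diag⁻¹ j

    -- By linearity the sum collects into a diagonal entry of `E i · E j`, normalised by `diag j`;
    -- orthogonality and idempotency then give the identity matrix.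
    Q·P : ∀ i j → ∑ (λ k → q i k * P k j) ≈ 𝟙 ⌊ i ≟ j ⌋
    Q·P i j = begin
      ∑ (λ k → q i k * P k j)
        ≈⟨ ∑-cong {e} (λ k → sym (*-assoc _ _ _)) ⟩
      ∑ (λ k → q i k * (adj k · E j) x x * diag⁻¹ j)
        ≈⟨ ∑-* {e} _ _ ⟨
      ∑ (λ k → q i k * (adj k · E j) x x) * diag⁻¹ j
        ≈⟨ *-congʳ (comb-· (q i) adj (E j) x x) ⟨
      (comb (q i) adj · E j) x x * diag⁻¹ j
        ≈⟨ *-congʳ (·-congʳ {N = E j} (E-adj i) x x) ⟩
      (E i · E j) x x * diag⁻¹ j
        ≈⟨ δ ⟩
      𝟙 ⌊ i ≟ j ⌋ ∎
      where
      x = base j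
      δ : (E i · E j) x x * diag⁻¹ j ≈ 𝟙 ⌊ i ≟ j ⌋
      δ with i ≟ j
      ... | yes ≡.refl = trans (*-congʳ (idem j x x)) (diag-inverse j)
      ... | no i≢j = trans (*-congʳ (orth i j i≢j x x)) (zeroˡ _)

    -- Pins the coefficients of an expansion known only to be not impossible to the explicit numbers
    -- `P k i`.
    P-unique : ∀ k a → adj k ≈M comb a E → ∀ i → P k i ≈ a i
    P-unique k a expand i = begin
      (adj k · E i) x x * diag⁻¹ i     ≈⟨ *-congʳ (·-congʳ {N = E i} expand x x) ⟩
      (comb a E · E i) x x * diag⁻¹ i  ≈⟨ *-congʳ (comb-·-E a i x x) ⟩
      a i * diag i * diag⁻¹ i          ≈⟨ *-assoc _ _ _ ⟩
      a i * (diag i * diag⁻¹ i)        ≈⟨ *-congˡ (diag-inverse i) ⟩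
      a i * 1#                         ≈⟨ *-identityʳ _ ⟩
      a i                              ∎
      where x = base i

    -- The matrix `1 - P Q`.
    Z : Fin e → Fin e → Carrier
    Z k l = 𝟙 ⌊ l ≟ k ⌋ - ∑ (λ i → P k i * q i l)

    -- At a pair of points in class `l`, the entry `Z k l` is the defect of the expansion of
    -- `adj k`.
    Z-Near0 : ∀ k l → Near0 (Z k l)
    Z-Near0 k l Z≉0 with rel-nonempty l
    ... | x , y , ≡.refl = adj-expand-¬¬ k λ { (a , expand) → Z≉0 (x-x≈0 (trans (expand x y)
      (∑-cong {e} (λ i → *-cong (sym (P-unique k a expand i)) (E-val i x y))))) }

    -- The vector `D` of defects at `(x , y)` is killed by `Q`, since `Q` sends the adjacency
    -- matrices to the `E i` and `Q P = 1`. Hence `1 - P Q` fixes `D`, and `nakayama` applies.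
    adj-expand : ∀ k → adj k ≈M comb (P k) E
    adj-expand k x y = x-y≈0⇒x≈y (nakayama Z D Z-Near0 fix k)
      where
      D : Fin e → Carrier
      D l = adj l x y - comb (P l) E x y
      Q·D : ∀ i → ∑ (λ l → q i l * D l) ≈ 0#
      Q·D i = begin
        ∑ (λ l → q i l * D l)
          ≈⟨ ∑-cong {e} (λ l → *-distribˡ-minus _ _ _) ⟩
        ∑ (λ l → q i l * adj l x y - q i l * comb (P l) E x y)
          ≈⟨ ∑-minus {e} _ _ ⟩
        comb (q i) adj x y - ∑ (λ l → q i l * comb (P l) E x y)
          ≈⟨ minus-cong (E-adj i x y) (sym (∑-assoc (q i) P (λ j → E j x y))) ⟩
        E i x y - ∑ (λ j → ∑ (λ l → q i l * P l j) * E j x y)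
          ≈⟨ x-x≈0 (sym (trans (∑-cong {e} (λ j → trans (*-congʳ (Q·P i j)) (*-comm _ _)))
                                (∑-𝟙 i (λ j → E j x y)))) ⟩
        0# ∎
      fix : ∀ k → D k ≈ ∑ (λ l → Z k l * D l)
      fix k = sym (begin
        ∑ (λ l → Z k l * D l)
          ≈⟨ ∑-cong {e} (λ l → *-distribʳ-minus _ _ _) ⟩
        ∑ (λ l → 𝟙 ⌊ l ≟ k ⌋ * D l - ∑ (λ i → P k i * q i l) * D l)
          ≈⟨ ∑-minus {e} _ _ ⟩
        ∑ (λ l → 𝟙 ⌊ l ≟ k ⌋ * D l) - ∑ (λ l → ∑ (λ i → P k i * q i l) * D l)
          ≈⟨ minus-cong (trans (∑-cong {e} (λ l → trans (*-comm _ _) (*-congˡ (𝟙-sym l k)))) (∑-𝟙 k D))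
                     (∑-assoc (P k) q D) ⟩
        D k - ∑ (λ i → P k i * ∑ (λ l → q i l * D l))
          ≈⟨ +-congˡ (-‿cong (∑-zero {e} (λ i → trans (*-congˡ (Q·D i)) (zeroʳ _)))) ⟩
        D k - 0#
          ≈⟨ minus-0 _ ⟩
        D k ∎)

    expand : ∀ (a : Fin e → Carrier) {M : Mat n} → M ≈M comb a adj → ∃[ b ] M ≈M comb b E
    expand a {M} eq = (λ i → ∑ (λ k → a k * P k i)) , λ x y → begin
      M x y                            ≈⟨ eq x y ⟩
      comb a adj x y                   ≈⟨ ∑-cong {e} (λ k → *-congˡ (adj-expand k x y)) ⟩
      ∑ (λ k → a k * comb (P k) E x y) ≈⟨ ∑-assoc a P (λ i → E i x y) ⟨
      comb (λ i → ∑ (λ k → a k * P k i)) E x y ∎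

  -- Linear functionals on matrices

  record Linear {n} (g : Mat n → Carrier) : Set (c ⊔ ℓ) where
    field
      resp : ∀ {M N} → M ≈M N → g M ≈ g N
      expand : ∀ {m} (a : Fin m → Carrier) (B : Fin m → Mat n) → g (comb a B) ≈ ∑ (λ i → a i * g (B i))

  open Linear

  module _ {n : ℕ} where

    linear-entry : ∀ x y → Linear {n} (λ M → M x y)
    linear-entry x y .resp eq = eq x y
    linear-entry x y .expand a B = refl

    linear-*ˡ : ∀ {b} {g : Mat n → Carrier} → Linear g → Linear (λ M → b * g M)
    linear-*ˡ l .resp eq = *-congˡ (l .resp eq)
    linear-*ˡ {b} {g} l .expand {m} a B = begin
      b * g (comb a B)               ≈⟨ *-congˡ (l .expand a B) ⟩
      b * ∑ (λ i → a i * g (B i))    ≈⟨ *-∑ {m} _ _ ⟩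
      ∑ (λ i → b * (a i * g (B i)))  ≈⟨ ∑-cong {m} (λ i → solve 3 (λ b a x → b :* (a :* x) := a :* (b :* x)) refl _ _ _) ⟩
      ∑ (λ i → a i * (b * g (B i)))  ∎

    linear-*ʳ : ∀ {b} {g : Mat n → Carrier} → Linear g → Linear (λ M → g M * b)
    linear-*ʳ l .resp eq = *-congʳ (l .resp eq)
    linear-*ʳ {b} {g} l .expand {m} a B = begin
      g (comb a B) * b               ≈⟨ *-congʳ (l .expand a B) ⟩
      ∑ (λ i → a i * g (B i)) * b    ≈⟨ ∑-* {m} _ _ ⟩
      ∑ (λ i → a i * g (B i) * b)    ≈⟨ ∑-cong {m} (λ i → *-assoc _ _ _) ⟩
      ∑ (λ i → a i * (g (B i) * b))  ∎

    linear-∑ : ∀ {k} {g : Fin k → Mat n → Carrier} → (∀ u → Linear (g u)) → Linear (λ M → ∑ (λ u → g u M))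
    linear-∑ {k} l .resp eq = ∑-cong {k} (λ u → l u .resp eq)
    linear-∑ {k} {g} l .expand {m} a B = begin
      ∑ (λ u → g u (comb a B))                ≈⟨ ∑-cong {k} (λ u → l u .expand a B) ⟩
      ∑ (λ u → ∑ (λ i → a i * g u (B i)))     ≈⟨ ∑-swap {k} {m} _ ⟩
      ∑ (λ i → ∑ (λ u → a i * g u (B i)))     ≈⟨ ∑-cong {m} (λ i → *-∑ {k} _ _) ⟨
      ∑ (λ i → a i * ∑ (λ u → g u (B i)))     ∎

    -- Lets a matrix act on one slot of a tensor while the other two are held fixed, so that
    -- `E i ⊗ E j ⊗ E k` can be applied as three successive maps.
    Maps : Mat n → (f f' : Fin n → Carrier) → Set ℓ
    Maps M f f' = ∀ x → ∑ (λ u → M x u * f u) ≈ f' x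

    Maps-*ʳ : ∀ {M f f' b} → Maps M f f' → Maps M (λ u → f u * b) (λ x → f' x * b)
    Maps-*ʳ h x = trans (∑-cong {n} (λ u → sym (*-assoc _ _ _))) (trans (sym (∑-* {n} _ _)) (*-congʳ (h x)))

    Maps-*ˡ : ∀ {M f f' b} → Maps M f f' → Maps M (λ u → b * f u) (λ x → b * f' x)
    Maps-*ˡ h x = trans
      (∑-cong {n} (λ u → solve 3 (λ m b y → m :* (b :* y) := b :* (m :* y)) refl _ _ _))
      (trans (sym (*-∑ {n} _ _)) (*-congˡ (h x)))

    Maps-∑ : ∀ {M k} {f f' : Fin k → Fin n → Carrier} → (∀ t → Maps M (f t) (f' t)) →
             Maps M (λ u → ∑ (λ t → f t u)) (λ x → ∑ (λ t → f' t x))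
    Maps-∑ {k = k} h x = trans (∑-cong {n} (λ u → *-∑ {k} _ _))
      (trans (∑-swap {n} {k} _) (∑-cong {k} (λ t → h t x)))

    Maps-unique : ∀ {M f g g'} → Maps M f f → (∀ u → f u ≈ g u) → Maps M g g' → ∀ x → f x ≈ g' x
    Maps-unique {M} fixed f≈g h x = trans (sym (fixed x)) (trans (∑-cong {n} (λ u → *-congˡ (f≈g u))) (h x))

  natF-injective : CharZero → ∀ m n → natF m ≈ natF n → m ≡ n
  natF-injective char0 zero zero _ = ≡.refl
  natF-injective char0 zero (suc n) eq = ⊥-elim (char0 n (sym eq))
  natF-injective char0 (suc m) zero eq = ⊥-elim (char0 m eq)
  natF-injective char0 (suc m) (suc n) eq = ≡.cong suc (natF-injective char0 m n (+-cancelˡ _ _ _ eq))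

module Scheme {c ℓ} (F : Field c ℓ) {n d : ℕ} (S : SymAssocScheme n d) where
  open Field F hiding (zero)
  open FieldOps F
  open LinearAlgebra F
  open SymAssocScheme S
  open SchemeOps S
  open Over F
  open Relation.Binary.Reasoning.Setoid setoid
  open Algebra.Solver.Ring.NaturalCoefficients.Default commutativeSemiring
    using (solve; _:*_; _:=_)

  -- The Bose–Mesner algebra

  -- Only the class containing `(x , y)` survives in the sum. Together with the converse `BM-intro`,
  -- this replaces membership in the span by dependence on the relation alone.
  BM-value : ∀ {M} ((a , _) : InBM M) x y → M x y ≈ a (rel x y)
  BM-value (a , eq) x y = trans (eq x y) (∑-𝟙 (rel x y) a)

  BM-intro : ∀ {M} (a : Fin (suc d) → Carrier) → (∀ x y → M x y ≈ a (rel x y)) → InBM M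
  BM-intro a eq = a , λ x y → trans (eq x y) (sym (∑-𝟙 (rel x y) a))

  BM-resp-rel : ∀ {M} → InBM M → ∀ {x y x' y'} → rel x y ≡ rel x' y' → M x y ≈ M x' y'
  BM-resp-rel b {x} {y} {x'} {y'} eq =
    trans (BM-value b x y) (trans (reflexive (≡.cong (proj₁ b) eq)) (sym (BM-value b x' y')))

  BM-sym : ∀ {M} → InBM M → ∀ x y → M x y ≈ M y x
  BM-sym b x y = BM-resp-rel b (rel-sym x y)

  A-BM : ∀ i → InBM (A i)
  A-BM i = BM-intro (λ k → 𝟙 ⌊ k ≟ i ⌋) (λ x y → refl)

  J : Mat n
  J _ _ = 1#

  J-BM : InBM J
  J-BM = BM-intro (λ _ → 1#) (λ x y → refl)

  I-BM : InBM I
  I-BM = BM-intro (λ k → 𝟙 ⌊ k ≟ zero ⌋) diagonal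
    where
    diagonal : ∀ x y → I x y ≈ 𝟙 ⌊ rel x y ≟ zero ⌋
    diagonal x y with x ≟ y
    ... | yes ≡.refl = sym (𝟙-≡ (rel-id₂ x))
    ... | no x≢y = sym (𝟙-≢ (λ eq → x≢y (rel-id₁ x y eq)))

  BM-⊖ : ∀ {M N} → InBM M → InBM N → InBM (M ⊖ N)
  BM-⊖ bM bN = BM-intro (λ k → proj₁ bM k - proj₁ bN k)
    (λ x y → minus-cong (BM-value bM x y) (BM-value bN x y))

  -- The structure constants of the algebra are the intersection numbers `p`.
  BM-· : ∀ {M N} → InBM M → InBM N → InBM (M · N)
  BM-· bM@(a , _) bN@(b , _) = BM-intro (λ k → ∑ (λ i → ∑ (λ j → a i * b j * natF (p i j k)))) λ x y →
    trans (∑-cong {n} (λ z → *-cong (BM-value bM x z) (BM-value bN z y)))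
      (trans (∑-by-class (rel x) (λ z → rel z y) a b)
        (∑-cong (λ i → ∑-cong (λ j → *-congˡ {a i * b j}
          (reflexive (≡.cong natF (p-spec i j (rel x y) x y ≡.refl)))))))

  -- The product lies in the algebra, so it is symmetric, while transposing it reverses the factors.
  ·-comm : ∀ {M N} → InBM M → InBM N → (M · N) ≈M (N · M)
  ·-comm {M} {N} bM bN x y = begin
    (M · N) x y   ≈⟨ BM-sym (BM-· bM bN) x y ⟩
    (M · N) y x   ≈⟨ ∑-cong {n} (λ z → trans (*-comm _ _) (*-cong (BM-sym bN z x) (BM-sym bM y z))) ⟩
    (N · M) x y   ∎

  -- Primitive idempotents

  -- `M` splits into the orthogonal idempotents `P` and `M ⊖ P`. A nonzero entry of the second would
  -- contradict primitivity, so each of its entries is `Near0`.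
  primitive-absorbs : ∀ {M P} → Primitive M → Idempotent P → (M · P) ≈M P → NonZeroM P →
                      ∀ x y → Near0 (M x y - P x y)
  primitive-absorbs {M} {P} ((bM , idemM) , _ , indecomposable) (bP , idemP) MP≈P P≉0 x y Q≉0 =
    indecomposable P Q (bP , idemP) (BM-⊖ bM bP , idemQ) P≉0 (x , y , Q≉0) PQ≈0
      (λ x y → sym (-‿cancel (M x y) (P x y)))
    where
    Q = M ⊖ P
    PM≈P : (P · M) ≈M P
    PM≈P x y = trans (·-comm bP bM x y) (MP≈P x y)
    PQ≈0 : (P · Q) ≈M (λ _ _ → 0#)
    PQ≈0 x y = trans (·-distribˡ-⊖ P M P x y) (x-x≈0 (trans (PM≈P x y) (sym (idemP x y))))
    idemQ : (Q · Q) ≈M Q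
    idemQ x y = begin
      (Q · Q) x y                    ≈⟨ ·-distribʳ-⊖ Q M P x y ⟩
      (M · Q) x y - (P · Q) x y      ≈⟨ minus-cong (·-distribˡ-⊖ M M P x y) (PQ≈0 x y) ⟩
      (M · M) x y - (M · P) x y - 0# ≈⟨ minus-0 _ ⟩
      (M · M) x y - (M · P) x y      ≈⟨ minus-cong (idemM x y) (MP≈P x y) ⟩
      Q x y                          ∎

  -- The product `P` is an idempotent absorbed by both factors. A nonzero entry of `P` would make
  -- `M` and `N` both agree with `P` up to double negation, hence with each other; so all entries of
  -- `P` are `Near0`.
  primitive-orthogonal : ∀ {M N} → Primitive M → Primitive N → ¬ (M ≈M N) → (M · N) ≈M (λ _ _ → 0#)
  primitive-orthogonal {M} {N} primM@((bM , idemM) , _) primN@((bN , idemN) , _) M≉N =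
    idempotent-Near0 idemP λ x y Pxy≉0 →
      ¬¬-∀ (λ x → ¬¬-∀ (λ y k →
          primitive-absorbs primM (bP , idemP) MP≈P (_ , _ , Pxy≉0) x y (λ M-P≈0 →
          primitive-absorbs primN (bP , idemP) NP≈P (_ , _ , Pxy≉0) x y (λ N-P≈0 →
          k (trans (x-y≈0⇒x≈y M-P≈0) (sym (x-y≈0⇒x≈y N-P≈0)))))))
        M≉N
    where
    P = M · N
    bP = BM-· bM bN
    MP≈P : (M · P) ≈M P
    MP≈P x y = begin
      (M · (M · N)) x y   ≈⟨ ·-assoc M M N x y ⟨
      ((M · M) · N) x y   ≈⟨ ·-congʳ {N = N} idemM x y ⟩
      (M · N) x y         ∎
    NP≈P : (N · P) ≈M P
    NP≈P x y = begin
      (N · (M · N)) x y   ≈⟨ ·-congˡ {M = N} (·-comm bM bN) x y ⟩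
      (N · (N · M)) x y   ≈⟨ ·-assoc N N M x y ⟨
      ((N · N) · M) x y   ≈⟨ ·-congʳ {N = M} idemN x y ⟩
      (N · M) x y         ≈⟨ ·-comm bN bM x y ⟩
      (M · N) x y         ∎
    idemP : (P · P) ≈M P
    idemP x y = begin
      ((M · N) · P) x y   ≈⟨ ·-assoc M N P x y ⟩
      (M · (N · P)) x y   ≈⟨ ·-congˡ {M = M} NP≈P x y ⟩
      (M · P) x y         ≈⟨ MP≈P x y ⟩
      P x y               ∎

  -- The spaces 𝐖

  _≈T_ : T3 n → T3 n → Set ℓ
  T ≈T T' = ∀ x y z → T x y z ≈ T' x y z

  module _ {m} {D : Diagram m} where

    W-resp : ∀ {T T'} → T ≈T T' → W D T → W D T'
    W-resp eq (N , coef , ws , bs , h) = N , coef , ws , bs , λ x y z → trans (sym (eq x y z)) (h x y z)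

    W-zero : W D (λ _ _ _ → 0#)
    W-zero = zero , (λ ()) , (λ ()) , (λ ()) , λ _ _ _ → refl

    W-cons : ∀ a {w T} → (∀ e → InBM (w e)) → W D T → W D (λ x y z → a * D w x y z + T x y z)
    W-cons a {w} b (N , coef , ws , bs , h) =
      suc N , (λ { zero → a ; (suc j) → coef j }) , (λ { zero → w ; (suc j) → ws j }) ,
      (λ { zero → b ; (suc j) → bs j }) , λ x y z → +-congˡ (h x y z)

    W-generator : ∀ {w} → (∀ e → InBM (w e)) → W D (D w)
    W-generator b = W-resp (λ x y z → trans (+-identityʳ _) (*-identityˡ _)) (W-cons 1# b W-zero)

    W-+ : ∀ {T T'} → W D T → W D T' → W D (λ x y z → T x y z + T' x y z)
    W-+ (N , coef , ws , bs , h) W' = W-resp (λ x y z → +-congʳ (sym (h x y z))) (add N coef ws bs W')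
      where
      add : ∀ N coef ws → (∀ j e → InBM (ws j e)) → ∀ {T} → W D T →
            W D (λ x y z → ∑ {N} (λ j → coef j * D (ws j) x y z) + T x y z)
      add zero coef ws bs W' = W-resp (λ x y z → sym (+-identityˡ _)) W'
      add (suc N) coef ws bs W' = W-resp (λ x y z → sym (+-assoc _ _ _))
        (W-cons (coef zero) (bs zero) (add N (λ j → coef (suc j)) (λ j → ws (suc j)) (λ j → bs (suc j)) W'))

    W-scale : ∀ a {T} → W D T → W D (λ x y z → a * T x y z)
    W-scale a (N , coef , ws , bs , h) = N , (λ j → a * coef j) , ws , bs ,
      λ x y z → trans (*-congˡ (h x y z)) (trans (*-∑ {N} _ _) (∑-cong {N} (λ j → sym (*-assoc _ _ _))))

    W-∑ : ∀ {k} (a : Fin k → Carrier) (T : Fin k → T3 n) → (∀ i → W D (T i)) →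
          W D (λ x y z → ∑ (λ i → a i * T i x y z))
    W-∑ {zero} a T h = W-zero
    W-∑ {suc k} a T h =
      W-+ (W-scale (a zero) (h zero)) (W-∑ (λ i → a (suc i)) (λ i → T (suc i)) (λ i → h (suc i)))

    W-linear : ∀ {k} (B : Fin k → Mat n) (g : Mat n → T3 n) → (∀ x y z → Linear (λ M → g M x y z)) →
               (∀ i → W D (g (B i))) → ∀ {M} → ∃[ a ] M ≈M comb a B → W D (g M)
    W-linear B g lin h {M} (a , eq) = W-resp
      (λ x y z → sym (trans (lin x y z .Linear.resp eq) (lin x y z .Linear.expand a B)))
      (W-∑ a (λ i → g (B i)) h)

    -- Expands the edge weights in `B` one edge at a time. Passing six separate matrices through
    -- `vec₆` exposes each of them to `W-linear`.
    W-multilinear : ∀ {k} (B : Fin k → Mat n) → (∀ {M} → InBM M → ∃[ a ] M ≈M comb a B) →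
      (G : Diagram 6) → let g = λ M₀ M₁ M₂ M₃ M₄ M₅ → G (vec₆ M₀ M₁ M₂ M₃ M₄ M₅) in
      (∀ M₁ M₂ M₃ M₄ M₅ x y z → Linear (λ M → g M M₁ M₂ M₃ M₄ M₅ x y z)) →
      (∀ M₀ M₂ M₃ M₄ M₅ x y z → Linear (λ M → g M₀ M M₂ M₃ M₄ M₅ x y z)) →
      (∀ M₀ M₁ M₃ M₄ M₅ x y z → Linear (λ M → g M₀ M₁ M M₃ M₄ M₅ x y z)) →
      (∀ M₀ M₁ M₂ M₄ M₅ x y z → Linear (λ M → g M₀ M₁ M₂ M M₄ M₅ x y z)) →
      (∀ M₀ M₁ M₂ M₃ M₅ x y z → Linear (λ M → g M₀ M₁ M₂ M₃ M M₅ x y z)) →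
      (∀ M₀ M₁ M₂ M₃ M₄ x y z → Linear (λ M → g M₀ M₁ M₂ M₃ M₄ M x y z)) →
      (∀ i₀ i₁ i₂ i₃ i₄ i₅ → W D (g (B i₀) (B i₁) (B i₂) (B i₃) (B i₄) (B i₅))) →
      ∀ (w : Fin 6 → Mat n) → (∀ e → InBM (w e)) → W D (g (w #0) (w #1) (w #2) (w #3) (w #4) (w #5))
    W-multilinear B spans G l₀ l₁ l₂ l₃ l₄ l₅ basis w b =
      W-linear B _ (l₀ _ _ _ _ _) (λ i₀ →
      W-linear B _ (l₁ _ _ _ _ _) (λ i₁ →
      W-linear B _ (l₂ _ _ _ _ _) (λ i₂ →
      W-linear B _ (l₃ _ _ _ _ _) (λ i₃ →
      W-linear B _ (l₄ _ _ _ _ _) (λ i₄ →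
      W-linear B _ (l₅ _ _ _ _ _) (λ i₅ →
        basis i₀ i₁ i₂ i₃ i₄ i₅)
      (spans (b #5))) (spans (b #4))) (spans (b #3))) (spans (b #2))) (spans (b #1))) (spans (b #0))

  W-mono : ∀ {m m'} {D : Diagram m} {D' : Diagram m'} →
           (∀ w → (∀ e → InBM (w e)) → W D' (D w)) → ∀ {T} → W D T → W D' T
  W-mono {D = D} {D'} h (N , coef , ws , bs , eq) =
    W-resp {D = D'} (λ x y z → sym (eq x y z)) (W-∑ {D = D'} coef (λ j → D (ws j)) (λ j → h (ws j) (bs j)))

  -- Triple regularity

  module _ (x y : Fin n) where

    linear-factor₀ : ∀ {b₁ b₂ b₃ b₄ b₅} → Linear (λ M → M x y * b₁ * b₂ * b₃ * b₄ * b₅)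
    linear-factor₀ = linear-*ʳ (linear-*ʳ (linear-*ʳ (linear-*ʳ (linear-*ʳ (linear-entry x y)))))

    linear-factor₁ : ∀ {b₀ b₂ b₃ b₄ b₅} → Linear (λ M → b₀ * M x y * b₂ * b₃ * b₄ * b₅)
    linear-factor₁ = linear-*ʳ (linear-*ʳ (linear-*ʳ (linear-*ʳ (linear-*ˡ (linear-entry x y)))))

    linear-factor₂ : ∀ {b₀ b₁ b₃ b₄ b₅} → Linear (λ M → b₀ * b₁ * M x y * b₃ * b₄ * b₅)
    linear-factor₂ = linear-*ʳ (linear-*ʳ (linear-*ʳ (linear-*ˡ (linear-entry x y))))

    linear-factor₃ : ∀ {b₀ b₁ b₂ b₄ b₅} → Linear (λ M → b₀ * b₁ * b₂ * M x y * b₄ * b₅)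
    linear-factor₃ = linear-*ʳ (linear-*ʳ (linear-*ˡ (linear-entry x y)))

    linear-factor₄ : ∀ {b₀ b₁ b₂ b₃ b₅} → Linear (λ M → b₀ * b₁ * b₂ * b₃ * M x y * b₅)
    linear-factor₄ = linear-*ʳ (linear-*ˡ (linear-entry x y))

    linear-factor₅ : ∀ {b₀ b₁ b₂ b₃ b₄} → Linear (λ M → b₀ * b₁ * b₂ * b₃ * b₄ * M x y)
    linear-factor₅ = linear-*ˡ (linear-entry x y)

  I-diagonal : ∀ x → I {n} x x ≈ 1#
  I-diagonal x = 𝟙-≡ ≡.refl

  I-off-diagonal : ∀ {x y} → x ≢ y → I {n} x y ≈ 0#
  I-off-diagonal = 𝟙-≢

  *-zero₃ : ∀ {a b c d} → b ≈ 0# → a * b * c * d ≈ 0#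
  *-zero₃ b≈0 = trans (*-congʳ (trans (*-congʳ (trans (*-congˡ b≈0) (zeroʳ _))) (zeroˡ _))) (zeroˡ _)

  -- The weight `I` on the edge from the centre to the first root merges the two, and `J` makes the
  -- other two spokes invisible.
  Δ⊆K : ∀ w → (∀ e → InBM (w e)) → W Kd (Δ w)
  Δ⊆K w b = W-resp {D = Kd} collapse (W-generator {D = Kd} {w = vec₆ (w #0) (w #1) (w #2) I J J}
    (λ { #0 → b #0 ; #1 → b #1 ; #2 → b #2 ; #3 → I-BM ; #4 → J-BM ; #5 → J-BM }))
    where
    collapse : Kd (vec₆ (w #0) (w #1) (w #2) I J J) ≈T Δ w
    collapse x y z = begin
      ∑ (λ c → Δ w x y z * I c x * 1# * 1#)   ≈⟨ ∑-single {n} x _ (λ c c≢x → *-zero₃ (I-off-diagonal c≢x)) ⟩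
      Δ w x y z * I x x * 1# * 1#             ≈⟨ trans (*-identityʳ _) (*-identityʳ _) ⟩
      Δ w x y z * I x x                       ≈⟨ trans (*-congˡ (I-diagonal x)) (*-identityʳ _) ⟩
      Δ w x y z                               ∎

  #common : (x y z : Fin n) (r s t : Fin (suc d)) → ℕ
  #common x y z r s t = count (λ w → ⌊ rel x w ≟ r ⌋ ∧ ⌊ rel y w ≟ s ⌋ ∧ ⌊ rel z w ≟ t ⌋)

  K-count : ∀ M₀ M₁ M₂ r s t x y z → Kd (vec₆ M₀ M₁ M₂ (A r) (A s) (A t)) x y z ≈
            M₀ x y * M₁ y z * M₂ z x * natF (#common x y z r s t)
  K-count M₀ M₁ M₂ r s t x y z = begin
    ∑ (λ c → m * A r c x * A s c y * A t c z)
      ≈⟨ ∑-cong {n} (λ c → trans (*-cong (*-cong (*-congˡ (BM-sym (A-BM r) c x)) (BM-sym (A-BM s) c y)) (BM-sym (A-BM t) c z))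
           (solve 4 (λ m a b c → m :* a :* b :* c := m :* (a :* (b :* c))) refl m _ _ _)) ⟩
    ∑ (λ c → m * (𝟙 ⌊ rel x c ≟ r ⌋ * (𝟙 ⌊ rel y c ≟ s ⌋ * 𝟙 ⌊ rel z c ≟ t ⌋)))
      ≈⟨ ∑-cong {n} (λ c → *-congˡ (trans (𝟙-∧ ⌊ rel x c ≟ r ⌋ _) (*-congˡ (𝟙-∧ ⌊ rel y c ≟ s ⌋ _)))) ⟨
    ∑ (λ c → m * 𝟙 (⌊ rel x c ≟ r ⌋ ∧ ⌊ rel y c ≟ s ⌋ ∧ ⌊ rel z c ≟ t ⌋))
      ≈⟨ *-∑ {n} _ _ ⟨
    m * ∑ (λ c → 𝟙 (⌊ rel x c ≟ r ⌋ ∧ ⌊ rel y c ≟ s ⌋ ∧ ⌊ rel z c ≟ t ⌋))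
      ≈⟨ *-congˡ (natF-count {n} _) ⟨
    m * natF (#common x y z r s t) ∎
    where m = M₀ x y * M₁ y z * M₂ z x

  -- Turns a factor depending on the relations of the points into a scalar: the indicators vanish
  -- unless the relations are the prescribed ones.
  𝟙-mask : ∀ {e} (f : Fin e → Fin e → Fin e → Carrier) a b c i j k →
           𝟙 ⌊ a ≟ i ⌋ * 𝟙 ⌊ b ≟ j ⌋ * 𝟙 ⌊ c ≟ k ⌋ * f a b c ≈
           𝟙 ⌊ a ≟ i ⌋ * 𝟙 ⌊ b ≟ j ⌋ * 𝟙 ⌊ c ≟ k ⌋ * f i j k
  𝟙-mask f a b c i j k with a ≟ i | b ≟ j | c ≟ k
  ... | yes ≡.refl | yes ≡.refl | yes ≡.refl = refl
  ... | no _ | _ | _ = trans vanish (sym vanish)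
    where
    vanish : ∀ {a b c} → 0# * a * b * c ≈ 0#
    vanish = trans (*-congʳ (trans (*-congʳ (zeroˡ _)) (zeroˡ _))) (zeroˡ _)
  ... | yes _ | no _ | _ = trans vanish (sym vanish)
    where
    vanish : ∀ {a b c} → a * 0# * b * c ≈ 0#
    vanish = *-zero₃ refl
  ... | yes _ | yes _ | no _ = trans vanish (sym vanish)
    where
    vanish : ∀ {a b} → a * 0# * b ≈ 0#
    vanish = trans (*-congʳ (zeroʳ _)) (zeroˡ _)

  -- With adjacency matrices as weights, the spokes contribute a count that triple regularity
  -- expresses through the relations of the roots. The outer edges prescribe those relations, so
  -- what remains is a multiple of a generator of `W Δ`.
  K⊆Δ : TriplyRegular → ∀ w → (∀ e → InBM (w e)) → W Δ (Kd w)
  K⊆Δ (q , regular) w b = W-multilinear {D = Δ} A (λ bM → bM) Kd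
    (λ _ _ _ _ _ x y z → linear-∑ {n} {k = n} (λ c → linear-factor₀ x y))
    (λ _ _ _ _ _ x y z → linear-∑ {n} {k = n} (λ c → linear-factor₁ y z))
    (λ _ _ _ _ _ x y z → linear-∑ {n} {k = n} (λ c → linear-factor₂ z x))
    (λ _ _ _ _ _ x y z → linear-∑ {n} {k = n} (λ c → linear-factor₃ c x))
    (λ _ _ _ _ _ x y z → linear-∑ {n} {k = n} (λ c → linear-factor₄ c y))
    (λ _ _ _ _ _ x y z → linear-∑ {n} {k = n} (λ c → linear-factor₅ c z))
    basis w b
    where
    basis : ∀ i j k r s t → W Δ (Kd (vec₆ (A i) (A j) (A k) (A r) (A s) (A t)))
    basis i j k r s t = W-resp {D = Δ} (λ x y z → sym (begin
      Kd (vec₆ (A i) (A j) (A k) (A r) (A s) (A t)) x y z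
        ≈⟨ K-count (A i) (A j) (A k) r s t x y z ⟩
      A i x y * A j y z * A k z x * natF (#common x y z r s t)
        ≡⟨ ≡.cong (λ m → A i x y * A j y z * A k z x * natF m) (regular x y z r s t) ⟩
      A i x y * A j y z * A k z x * natF (q r s t (rel y z) (rel z x) (rel x y))
        -- The arguments rotate because `q` starts from the relation of `y` and `z`, whereas `Δ`
        -- starts from the edge between `x` and `y`.
        ≈⟨ 𝟙-mask (λ i j k → natF (q r s t j k i)) (rel x y) (rel y z) (rel z x) i j k ⟩
      A i x y * A j y z * A k z x * natF (q r s t j k i)
        ≈⟨ *-comm _ _ ⟩
      natF (q r s t j k i) * Δ (vec₃ (A i) (A j) (A k)) x y z ∎))
      (W-scale {D = Δ} (natF (q r s t j k i)) (W-generator {D = Δ} {w = vec₃ (A i) (A j) (A k)}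
        (λ { #0 → A-BM i ; #1 → A-BM j ; #2 → A-BM k })))

  WΔ-resp-rel : ∀ {T} → W Δ T → ∀ {x y z x' y' z'} →
                rel x y ≡ rel x' y' → rel y z ≡ rel y' z' → rel z x ≡ rel z' x' → T x y z ≈ T x' y' z'
  WΔ-resp-rel (N , coef , ws , bs , h) {x} {y} {z} {x'} {y'} {z'} exy eyz ezx = trans (h x y z) (trans
    (∑-cong {N} (λ j → *-congˡ (*-cong (*-cong (BM-resp-rel (bs j #0) exy) (BM-resp-rel (bs j #1) eyz))
      (BM-resp-rel (bs j #2) ezx))))
    (sym (h x' y' z')))

  -- With `J` on the outer edges, the tensor of `K` is the bare count. Membership in `W Δ` makes its
  -- image in the field depend only on the relations, and characteristic zero brings this back to
  -- natural numbers.
  WK⊆WΔ⇒triplyRegular : CharZero → (∀ T → W Kd T → W Δ T) → TriplyRegular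
  WK⊆WΔ⇒triplyRegular char0 K⊆Δ = q , regular
    where
    #common-resp-rel : ∀ r s t {x y z x' y' z'} → rel y z ≡ rel y' z' → rel z x ≡ rel z' x' →
                       rel x y ≡ rel x' y' → #common x y z r s t ≡ #common x' y' z' r s t
    #common-resp-rel r s t {x} {y} {z} {x'} {y'} {z'} eyz ezx exy =
      natF-injective char0 (#common x y z r s t) (#common x' y' z' r s t) (begin
        natF (#common x y z r s t)    ≈⟨ tensor x y z ⟨
        T x y z                       ≈⟨ WΔ-resp-rel T∈WΔ exy eyz ezx ⟩
        T x' y' z'                    ≈⟨ tensor x' y' z' ⟩
        natF (#common x' y' z' r s t) ∎)
      where
      T = Kd (vec₆ J J J (A r) (A s) (A t))
      tensor : ∀ x y z → T x y z ≈ natF (#common x y z r s t)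
      tensor x y z = trans (K-count J J J r s t x y z)
        (trans (*-congʳ (trans (*-identityʳ _) (*-identityʳ _))) (*-identityˡ _))
      T∈WΔ : W Δ T
      T∈WΔ = K⊆Δ T (W-generator {D = Kd} {w = vec₆ J J J (A r) (A s) (A t)}
        (λ { #0 → J-BM ; #1 → J-BM ; #2 → J-BM ; #3 → A-BM r ; #4 → A-BM s ; #5 → A-BM t }))
    Triple : (i j k : Fin (suc d)) → Set
    Triple i j k = ∃[ x ] ∃[ y ] ∃[ z ] (rel y z ≡ i × rel z x ≡ j × rel x y ≡ k)
    triple? : ∀ i j k → Dec (Triple i j k)
    triple? i j k = any? (λ x → any? (λ y → any? (λ z →
      (rel y z ≟ i) ×-dec (rel z x ≟ j) ×-dec (rel x y ≟ k))))
    q : (r s t i j k : Fin (suc d)) → ℕ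
    q r s t i j k with triple? i j k
    ... | yes (x , y , z , _) = #common x y z r s t
    -- No three points have these relations, so any value would serve.
    ... | no _ = 0
    regular : ∀ x y z r s t → #common x y z r s t ≡ q r s t (rel y z) (rel z x) (rel x y)
    regular x y z r s t with triple? (rel y z) (rel z x) (rel x y)
    ... | yes (_ , _ , _ , eyz , ezx , exy) = #common-resp-rel r s t (≡.sym eyz) (≡.sym ezx) (≡.sym exy)
    ... | no none = ⊥-elim (none (x , y , z , ≡.refl , ≡.refl , ≡.refl))

  -- Dual triple regularity

  -- Two edges of the inner triangle weighted by `I` contract it to a single node; the third then
  -- carries `J`, which contributes `1#`.
  Y⊆N : ∀ w → (∀ e → InBM (w e)) → W Nd (Yd w)
  Y⊆N w b = W-resp {D = Nd} collapse (W-generator {D = Nd} {w = vec₆ I I J (w #0) (w #1) (w #2)}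
    (λ { #0 → I-BM ; #1 → I-BM ; #2 → J-BM ; #3 → b #0 ; #4 → b #1 ; #5 → b #2 }))
    where
    *-zero₆ : ∀ {a b c d e} → 0# * a * b * c * d * e ≈ 0#
    *-zero₆ {a} {b} {c} {d} {e} = trans
      (solve 6 (λ o a b c d e → o :* a :* b :* c :* d :* e := o :* (a :* b :* c :* d :* e)) refl 0# a b c d e)
      (zeroˡ _)
    collapse : Nd (vec₆ I I J (w #0) (w #1) (w #2)) ≈T Yd w
    collapse x y z = ∑-cong {n} (λ t₁ → begin
      ∑ (λ t₂ → ∑ (λ t₃ → I t₁ t₂ * I t₂ t₃ * 1# * w #0 x t₁ * w #1 y t₂ * w #2 z t₃))
        ≈⟨ ∑-single {n} t₁ _ (λ t₂ t₂≢t₁ → ∑-zero {n} (λ t₃ → trans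
             (*-congʳ (*-congʳ (*-congʳ (*-congʳ (*-congʳ (I-off-diagonal (λ eq → t₂≢t₁ (≡.sym eq))))))))
             *-zero₆)) ⟩
      ∑ (λ t₃ → I t₁ t₁ * I t₁ t₃ * 1# * w #0 x t₁ * w #1 y t₁ * w #2 z t₃)
        ≈⟨ ∑-single {n} t₁ _ (λ t₃ t₃≢t₁ → trans
             (*-congʳ (*-congʳ (*-congʳ (*-congʳ (trans (*-comm _ _)
               (*-congʳ (I-off-diagonal (λ eq → t₃≢t₁ (≡.sym eq)))))))))
             *-zero₆) ⟩
      I t₁ t₁ * I t₁ t₁ * 1# * w #0 x t₁ * w #1 y t₁ * w #2 z t₁
        ≈⟨ *-cong (*-cong (*-cong (trans (*-identityʳ _) (trans (*-cong (I-diagonal t₁) (I-diagonal t₁)) (*-identityʳ _)))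
             (BM-sym (b #0) x t₁)) (BM-sym (b #1) y t₁)) (BM-sym (b #2) z t₁) ⟩
      1# * w #0 t₁ x * w #1 t₁ y * w #2 t₁ z
        ≈⟨ *-congʳ (*-congʳ (*-identityˡ _)) ⟩
      w #0 t₁ x * w #1 t₁ y * w #2 t₁ z ∎)

  module Dual (char0 : CharZero) (E : Fin (suc d) → Mat n) (primitives : PrimitiveIdempotents E) where

    E-BM : ∀ i → InBM (E i)
    E-BM i = proj₁ (proj₁ (proj₁ primitives i))

    E-idem : ∀ i → (E i · E i) ≈M E i
    E-idem i = proj₂ (proj₁ (proj₁ primitives i))

    -- Row `i` of the matrix `q` is the coefficient vector that witnesses `InBM (E i)`.
    open Spectral char0 rel rel-sym rel-nonempty E (λ i → proj₁ (E-BM i)) (λ i → BM-value (E-BM i)) E-idem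
      (λ i j i≢j → primitive-orthogonal (proj₁ primitives i) (proj₁ primitives j)
        (λ eq → i≢j (proj₁ (proj₂ primitives) i j eq)))
      (λ i → proj₁ (proj₂ (proj₁ primitives i)))
      using (expand; comb-·-E)

    E-spans : ∀ {M} → InBM M → ∃[ a ] M ≈M comb a E
    E-spans (a , eq) = expand a eq

    eigenvalue : ∀ {M} → InBM M → ∀ i → ∃[ μ ] (∀ x y → (M · E i) x y ≈ μ * E i x y)
    eigenvalue bM i = proj₁ (E-spans bM) i , λ x y →
      trans (·-congʳ {N = E i} (proj₂ (E-spans bM)) x y) (comb-·-E (proj₁ (E-spans bM)) i x y)

    dualLHS : (i j k r s t : Fin (suc d)) → T3 n
    dualLHS i j k r s t x y z = ∑ (λ u → ∑ (λ v → ∑ (λ w →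
      E i x u * E j y v * E k z w * E r v w * E s w u * E t u v)))

    star : (i j k : Fin (suc d)) → T3 n
    star i j k x y z = ∑ (λ w → E i x w * E j y w * E k z w)

    N-E : ∀ i j k r s t → Nd (vec₆ (E t) (E r) (E s) (E i) (E j) (E k)) ≈T dualLHS i j k r s t
    N-E i j k r s t x y z = ∑-cong {n} (λ u → ∑-cong {n} (λ v → ∑-cong {n} (λ w →
      solve 6 (λ t r s i j k → t :* r :* s :* i :* j :* k := i :* j :* k :* r :* s :* t) refl
        (E t u v) (E r v w) (E s w u) (E i x u) (E j y v) (E k z w))))

    Y-E : ∀ i j k → Yd (vec₃ (E i) (E j) (E k)) ≈T star i j k
    Y-E i j k x y z = ∑-cong {n} (λ w →
      *-cong (*-cong (BM-sym (E-BM i) w x) (BM-sym (E-BM j) w y)) (BM-sym (E-BM k) w z))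

    linear-∑³ : ∀ {g : Fin n → Fin n → Fin n → Mat n → Carrier} → (∀ t₁ t₂ t₃ → Linear (g t₁ t₂ t₃)) →
                Linear (λ M → ∑ (λ t₁ → ∑ (λ t₂ → ∑ (λ t₃ → g t₁ t₂ t₃ M))))
    linear-∑³ l = linear-∑ {n} {k = n} (λ t₁ → linear-∑ {n} {k = n} (λ t₂ → linear-∑ {n} {k = n} (l t₁ t₂)))

    -- Once all six weights are idempotents `E`, the tensor is the left-hand side of dual triple
    -- regularity, hence `σ` times a generator of `W Yd`.
    N⊆Y : DuallyTriplyRegular E → ∀ w → (∀ e → InBM (w e)) → W Yd (Nd w)
    N⊆Y dual w b = W-multilinear {D = Yd} E E-spans Nd
      (λ _ _ _ _ _ x y z → linear-∑³ (λ t₁ t₂ t₃ → linear-factor₀ t₁ t₂))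
      (λ _ _ _ _ _ x y z → linear-∑³ (λ t₁ t₂ t₃ → linear-factor₁ t₂ t₃))
      (λ _ _ _ _ _ x y z → linear-∑³ (λ t₁ t₂ t₃ → linear-factor₂ t₃ t₁))
      (λ _ _ _ _ _ x y z → linear-∑³ (λ t₁ t₂ t₃ → linear-factor₃ x t₁))
      (λ _ _ _ _ _ x y z → linear-∑³ (λ t₁ t₂ t₃ → linear-factor₄ y t₂))
      (λ _ _ _ _ _ x y z → linear-∑³ (λ t₁ t₂ t₃ → linear-factor₅ z t₃))
      (λ t r s i j k → let (σ , eq) = dual i j k r s t in W-resp {D = Yd}
        (λ x y z → sym (trans (N-E i j k r s t x y z) (trans (eq x y z) (*-congˡ (sym (Y-E i j k x y z))))))
        (W-scale {D = Yd} σ (W-generator {D = Yd} {w = vec₃ (E i) (E j) (E k)}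
          (λ { #0 → E-BM i ; #1 → E-BM j ; #2 → E-BM k }))))
      w b

    -- The tensor on the left of dual triple regularity is fixed by Eᵢ ⊗ Eⱼ ⊗ Eₖ, which maps every
    -- generator of 𝐖(Y) to a multiple of the one labelled Eᵢ, Eⱼ, Eₖ.
    WN⊆WY⇒duallyTriplyRegular : (∀ T → W Nd T → W Yd T) → DuallyTriplyRegular E
    WN⊆WY⇒duallyTriplyRegular N⊆Y i j k r s t
      with N⊆Y (dualLHS i j k r s t) (W-resp {D = Nd} (N-E i j k r s t)
        (W-generator {D = Nd} {w = vec₆ (E t) (E r) (E s) (E i) (E j) (E k)}
          (λ { #0 → E-BM t ; #1 → E-BM r ; #2 → E-BM s ; #3 → E-BM i ; #4 → E-BM j ; #5 → E-BM k })))
    -- Projecting the generator numbered `l` multiplies its three legs by eigenvalues, and the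
    -- scalar collects these products.
    ... | N , coef , ws , bs , h = ∑ (λ l → coef l * (λ₀ l * λ₁ l * λ₂ l)) , λ x y z → begin
      T x y z
        ≈⟨ project₂ x y z ⟩
      ∑ (λ l → coef l * ∑ (λ c → λ₀ l * E i x c * (λ₁ l * E j y c) * (λ₂ l * E k z c)))
        ≈⟨ ∑-cong {N} (λ l → *-congˡ (∑-cong {n} (λ c →
             solve 6 (λ a x b y c z → a :* x :* (b :* y) :* (c :* z) := a :* b :* c :* (x :* y :* z)) refl
               (λ₀ l) (E i x c) (λ₁ l) (E j y c) (λ₂ l) (E k z c)))) ⟩
      ∑ (λ l → coef l * ∑ (λ c → λ₀ l * λ₁ l * λ₂ l * (E i x c * E j y c * E k z c)))
        ≈⟨ ∑-cong {N} (λ l → trans (*-assoc _ _ _) (*-congˡ (*-∑ {n} _ _))) ⟨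
      ∑ (λ l → coef l * (λ₀ l * λ₁ l * λ₂ l) * star i j k x y z)
        ≈⟨ ∑-* {N} _ _ ⟨
      ∑ (λ l → coef l * (λ₀ l * λ₁ l * λ₂ l)) * star i j k x y z ∎
      where
      T = dualLHS i j k r s t
      λ₀ λ₁ λ₂ : Fin N → Carrier
      λ₀ l = proj₁ (eigenvalue (bs l #0) i)
      λ₁ l = proj₁ (eigenvalue (bs l #1) j)
      λ₂ l = proj₁ (eigenvalue (bs l #2) k)
      column : ∀ {M} (bM : InBM M) i c → Maps (E i) (λ u → M c u) (λ x → proj₁ (eigenvalue bM i) * E i x c)
      column {M} bM i c x = begin
        ∑ (λ u → E i x u * M c u)  ≈⟨ ∑-cong {n} (λ u → trans (*-comm _ _) (*-congˡ (BM-sym (E-BM i) x u))) ⟩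
        (M · E i) c x              ≈⟨ proj₂ (eigenvalue bM i) c x ⟩
        μ * E i c x                ≈⟨ *-congˡ (BM-sym (E-BM i) c x) ⟩
        μ * E i x c                ∎
        where μ = proj₁ (eigenvalue bM i)
      -- The variable `x` enters `T` only through the factor `E i x u`, which `E i` reproduces by
      -- idempotency.
      fixed₀ : ∀ y z → Maps (E i) (λ x → T x y z) (λ x → T x y z)
      fixed₀ y z = Maps-∑ {k = n} (λ u → Maps-∑ {k = n} (λ v → Maps-∑ {k = n} (λ w →
        Maps-*ʳ (Maps-*ʳ (Maps-*ʳ (Maps-*ʳ (Maps-*ʳ (λ x → E-idem i x u))))))))
      fixed₁ : ∀ x z → Maps (E j) (λ y → T x y z) (λ y → T x y z)
      fixed₁ x z = Maps-∑ {k = n} (λ u → Maps-∑ {k = n} (λ v → Maps-∑ {k = n} (λ w →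
        Maps-*ʳ (Maps-*ʳ (Maps-*ʳ (Maps-*ʳ (Maps-*ˡ (λ y → E-idem j y v))))))))
      fixed₂ : ∀ x y → Maps (E k) (λ z → T x y z) (λ z → T x y z)
      fixed₂ x y = Maps-∑ {k = n} (λ u → Maps-∑ {k = n} (λ v → Maps-∑ {k = n} (λ w →
        Maps-*ʳ (Maps-*ʳ (Maps-*ʳ (Maps-*ˡ (λ z → E-idem k z w)))))))
      -- The legs are projected in turn; each step leaves the other two untouched and starts from
      -- the formula obtained before.
      project₀ : ∀ x y z → T x y z ≈ ∑ (λ l → coef l * ∑ (λ c → λ₀ l * E i x c * ws l #1 c y * ws l #2 c z))
      project₀ x y z = Maps-unique (fixed₀ y z) (λ u → h u y z)
        (Maps-∑ {k = N} (λ l → Maps-*ˡ (Maps-∑ {k = n} (λ c → Maps-*ʳ (Maps-*ʳ (column (bs l #0) i c)))))) x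
      project₁ : ∀ x y z → T x y z ≈ ∑ (λ l → coef l * ∑ (λ c → λ₀ l * E i x c * (λ₁ l * E j y c) * ws l #2 c z))
      project₁ x y z = Maps-unique (fixed₁ x z) (λ u → project₀ x u z)
        (Maps-∑ {k = N} (λ l → Maps-*ˡ (Maps-∑ {k = n} (λ c → Maps-*ʳ (Maps-*ˡ (column (bs l #1) j c)))))) y
      project₂ : ∀ x y z → T x y z ≈ ∑ (λ l → coef l * ∑ (λ c → λ₀ l * E i x c * (λ₁ l * E j y c) * (λ₂ l * E k z c)))
      project₂ x y z = Maps-unique (fixed₂ x y) (λ u → project₁ x y u)
        (Maps-∑ {k = N} (λ l → Maps-*ˡ (Maps-∑ {k = n} (λ c → Maps-*ˡ (column (bs l #2) k c))))) z

theorem6p1 : ∀ {c ℓ} (F : Field c ℓ) → FieldOps.CharZero F →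
    ∀ {n d} (S : SymAssocScheme n d) (E : Fin (suc d) → FieldOps.Mat F n) →
    SchemeOps.Over.PrimitiveIdempotents S F E →
    (SchemeOps.TriplyRegular S ⇔ SchemeOps.Over._≡W_ S F (SchemeOps.Over.Δ S F) (SchemeOps.Over.Kd S F))
    × (SchemeOps.Over.DuallyTriplyRegular S F E ⇔ SchemeOps.Over._≡W_ S F (SchemeOps.Over.Yd S F) (SchemeOps.Over.Nd S F))
theorem6p1 F char0 S E primitives =
    mk⇔ (λ regular T → W-mono {D = Δ} {Kd} Δ⊆K , W-mono {D = Kd} {Δ} (K⊆Δ regular))
        (λ eq → WK⊆WΔ⇒triplyRegular char0 (λ T → proj₂ (eq T)))
  , mk⇔ (λ dual T → W-mono {D = Yd} {Nd} Y⊆N , W-mono {D = Nd} {Yd} (N⊆Y dual))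
        (λ eq → WN⊆WY⇒duallyTriplyRegular (λ T → proj₂ (eq T)))
  where
  open SchemeOps.Over S F
  open Scheme F S
  open Dual char0 E primitives
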